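{- Let $n\ge 1$. There is an involution $\phi$ on the set of improper noncrossing trees with $n$ edges such that, for every such tree $T$, the numbers of descents of $T$ and of $\phi(T)$ have opposite parity. Consequently $$e_n-o_n=t_n,$$ where $e_n$ (resp. $o_n$) is the number of noncrossing trees with $n$ edges having an even (resp. odd) number of descents, and $t_n$ is the number of proper noncrossing trees with $n$ edges.
   Context: A noncrossing tree with $n$ edges is a tree on the vertex set $\{1,\dots,n+1\}$, the vertices placed in counterclockwise order on a circle, with edges drawn as chords inside the circle that pairwise do not cross. It is rooted at vertex $1$. A descent is an edge $(i,j)$ with $i>j$ such that $i$ is the parent of $j$. Equivalently, a noncrossing tree is represented as a rooted plane tree in which each non-root vertex $j$ with parent $i$ is labeled $L$ if $i>j$ and $R$ if $i<j$; the root is unlabeled and all children of the root are labeled $R$. A child labeled $L$ is a "left child", a child labeled $R$ is a "right child"; descents correspond to $L$-labeled vertices. A noncrossing tree is even if its number of descents is even, odd otherwise. If the tree is even, a non-root vertex $v$ is proper if it has an even number of left children and no right child; if the tree is odd, a non-root vertex $v$ is proper if it has an even number of right children and no left child. A noncrossing tree is proper if every non-root vertex is proper, and improper otherwise. -}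

module Defs where

open import Data.Bool using (Bool; true; false; _∧_; _∨_; not; T)
open import Data.Nat using (ℕ; zero; suc; _+_; _<ᵇ_; _≡ᵇ_; _≤ᵇ_)
open import Data.List using (List; []; _∷_; map; upTo; filterᵇ; length; concatMap)
open import Data.Vec using (Vec; []; _∷_)
open import Data.Product using (Σ)

-- Encoding of a (rooted) tree on the vertex set {1,…,n+1}, rooted at 1:
-- a vector  v : Vec ℕ n  whose k-th entry (0-indexed) is the parent of
-- vertex k+2.  Every rooted tree on {1,…,n+1} with root 1 corresponds to
-- exactly one such vector satisfying 'isTree' below, and vice versa.

-- parent of vertex j (meaningful for 2 ≤ j ≤ n+1; junk value 0 otherwise)
par : ∀ {n} → Vec ℕ n → ℕ → ℕ
par []      _                   = 0
par (x ∷ v) (suc (suc zero))    = x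
par (x ∷ v) (suc (suc (suc j))) = par v (suc (suc j))
par (x ∷ v) _                   = 0

all : {A : Set} → (A → Bool) → List A → Bool
all p []       = true
all p (x ∷ xs) = p x ∧ all p xs

nonRoot : ℕ → List ℕ
nonRoot n = map (λ k → 2 + k) (upTo n)

reachesRoot : ∀ {n} → Vec ℕ n → ℕ → ℕ → Bool
reachesRoot v zero     j = j ≡ᵇ 1
reachesRoot v (suc f)  j = (j ≡ᵇ 1) ∨ reachesRoot v f (par v j)

isTree : ∀ {n} → Vec ℕ n → Bool
isTree {n} v = all (λ j → (1 ≤ᵇ par v j) ∧ (par v j ≤ᵇ suc n) ∧ reachesRoot v n j) (nonRoot n)

-- chords {a,b} and {c,d} of the circle (vertices in cyclic order) cross
-- in the interior iff their endpoints strictly interleave.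
min max : ℕ → ℕ → ℕ
min a b = if' (a ≤ᵇ b) a b
  where
  if' : Bool → ℕ → ℕ → ℕ
  if' true x _ = x
  if' false _ y = y
max a b = if' (a ≤ᵇ b) b a
  where
  if' : Bool → ℕ → ℕ → ℕ
  if' true x _ = x
  if' false _ y = y

crossᵇ : ℕ → ℕ → ℕ → ℕ → Bool
crossᵇ a b c d = ((a <ᵇ c) ∧ (c <ᵇ b) ∧ (b <ᵇ d)) ∨ ((c <ᵇ a) ∧ (a <ᵇ d) ∧ (d <ᵇ b))

edgesCross : ∀ {n} → Vec ℕ n → ℕ → ℕ → Bool
edgesCross v j k =
  crossᵇ (min j (par v j)) (max j (par v j)) (min k (par v k)) (max k (par v k))

isNCT : ∀ {n} → Vec ℕ n → Bool
isNCT {n} v = isTree v ∧ all (λ j → all (λ k → not (edgesCross v j k)) (nonRoot n)) (nonRoot n)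

NCTree : ℕ → Set
NCTree n = Σ (Vec ℕ n) (λ v → T (isNCT v))

descents : ∀ {n} → Vec ℕ n → ℕ
descents {n} v = length (filterᵇ (λ j → j <ᵇ par v j) (nonRoot n))

leftChildren : ∀ {n} → Vec ℕ n → ℕ → ℕ
leftChildren {n} v u = length (filterᵇ (λ j → (par v j ≡ᵇ u) ∧ (j <ᵇ u)) (nonRoot n))

rightChildren : ∀ {n} → Vec ℕ n → ℕ → ℕ
rightChildren {n} v u = length (filterᵇ (λ j → (par v j ≡ᵇ u) ∧ (u <ᵇ j)) (nonRoot n))

evenᵇ : ℕ → Bool
evenᵇ zero          = true
evenᵇ (suc zero)    = false
evenᵇ (suc (suc k)) = evenᵇ k

isEvenTree : ∀ {n} → Vec ℕ n → Bool
isEvenTree v = evenᵇ (descents v)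

isProperVertex : ∀ {n} → Vec ℕ n → ℕ → Bool
isProperVertex v u with isEvenTree v
... | true  = evenᵇ (leftChildren v u) ∧ (rightChildren v u ≡ᵇ 0)
... | false = evenᵇ (rightChildren v u) ∧ (leftChildren v u ≡ᵇ 0)

isProper : ∀ {n} → Vec ℕ n → Bool
isProper {n} v = all (isProperVertex v) (nonRoot n)

ImproperNCT : ℕ → Set
ImproperNCT n = Σ (Vec ℕ n) (λ v → T (isNCT v ∧ not (isProper v)))

allVecs : (k : ℕ) → List ℕ → List (Vec ℕ k)
allVecs zero    xs = [] ∷ []
allVecs (suc k) xs = concatMap (λ x → map (λ w → x ∷ w) (allVecs k xs)) xs

candidates : (n : ℕ) → List (Vec ℕ n)
candidates n = allVecs n (map suc (upTo (suc n)))

eCount oCount tCount : ℕ → ℕ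
eCount n = length (filterᵇ (λ v → isNCT v ∧ isEvenTree v) (candidates n))
oCount n = length (filterᵇ (λ v → isNCT v ∧ not (isEvenTree v)) (candidates n))
tCount n = length (filterᵇ (λ v → isNCT v ∧ isProper v) (candidates n))

{-# OPTIONS --safe #-}
module Submission where

-- Read the children of the root from the outermost inwards.  A noncrossing tree
-- then becomes a ternary tree: the outermost child, with its left and right parts,
-- and the tree with the remaining children.  An outermost right child of a vertex
-- has the same data as an outermost left child, so it can be moved from one side to
-- the other, which changes the number of descents by one.  Doing so at the first
-- non-root vertex that does not have an even number of left children and no right
-- child (adding a left child if their number is even, dropping one otherwise) is
-- the involution.  A proper tree is even: a proper odd tree would have no descent.

open import Defs
open import Data.Bool using (Bool; true; false; _∧_; not; T)
open import Data.Bool.Properties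
  using (T-∧; T-∨; T-≡; T-not-≡; not-involutive; ¬-not; not-¬; ∧-comm; ∧-assoc; ∧-zeroʳ; ∧-identityʳ)
open import Data.Integer using (+_; _-_; _⊖_)
open import Data.Integer.Properties using (m-n≡m⊖n; ⊖-≥)
open import Data.List using
  (List; []; _∷_; _++_; length; filterᵇ; map; upTo; applyUpTo; concatMap; cartesianProductWith)
open import Data.List.Membership.Propositional using (_∈_)
open import Data.List.Membership.Propositional.Properties
  using (∈-map⁺; ∈-map⁻; ∈-upTo⁺; ∈-upTo⁻; ∈-filter⁺; ∈-filter⁻; ∈-cartesianProductWith⁺)
open import Data.List.Membership.Propositional.Properties.WithK using (unique∧set⇒bag)
open import Data.List.Properties using (length-++; length-map; filter-++; map-applyUpTo)
open import Data.List.Relation.Binary.BagAndSetEquality using (∼bag⇒↭)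
open import Data.List.Relation.Binary.Permutation.Propositional.Properties using (↭-length)
open import Data.List.Relation.Unary.All using ([]; _∷_)
open import Data.List.Relation.Unary.Any using (here; there)
open import Data.List.Relation.Unary.Unique.Propositional using (Unique; []; _∷_)
import Data.List.Relation.Unary.Unique.Propositional.Properties as Unique
open import Data.Nat using
  (ℕ; zero; suc; _+_; _∸_; _≤_; _<_; _⊓_; _⊔_; z≤n; s≤s; _≤?_; _<?_; _≟_; _≤ᵇ_; _<ᵇ_; _≡ᵇ_)
open import Data.Nat.Properties hiding (_≤?_; _<?_; _≟_)
open import Data.Nat.Solver using (module +-*-Solver)
open import Data.Product using (Σ; ∃; ∃₂; _×_; _,_; proj₁; proj₂)
open import Data.Sum using (_⊎_; inj₁; inj₂; swap)
open import Data.Unit using (tt)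
open import Data.Vec using (Vec; []; _∷_)
open import Data.Vec.Properties using (∷-injective)
open import Function using (_∘_; id)
open import Function.Bundles using (Equivalence; mk⇔)
open import Relation.Binary.Definitions using (tri<; tri≈; tri>)
open import Relation.Binary.PropositionalEquality
open import Relation.Nullary using (Dec; ¬_; yes; no; contradiction; T?)
open import Relation.Nullary.Decidable using (_×-dec_; _→-dec_)
open import Relation.Unary using (Decidable)
open Equivalence using (to; from)

-- Properness refers to the parity of the whole tree, which a move changes, so the rule for the move
-- uses the condition for even trees throughout. An odd tree fails that condition too, since even
-- numbers of left children add up to an even number of descents. Hence every odd tree takes part in
-- the pairing, and the even trees left over are exactly the proper ones.
--
-- The move undoes itself because of the order in which the vertices are examined: the inner
-- siblings, then the vertex itself, then its left part. A vertex that passes has no right part to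
-- examine. Adding a left child leaves the vertex with an odd number of them, dropping one leaves it
-- with a right child, so it stays the first to fail.
--
-- Labels are positions on the circle, so moving one child shifts the labels of other vertices. The
-- involution is therefore defined on unlabelled shapes, and most of the work is to show that
-- noncrossing parent vectors and shapes determine each other.

infix 4 _∈⟨_,_] _∈[_,_⟩ _∈[_,_]

_∈⟨_,_] _∈[_,_⟩ _∈[_,_] : ℕ → ℕ → ℕ → Set
x ∈⟨ a , b ] = a < x × x ≤ b
x ∈[ a , b ⟩ = a ≤ x × x < b
x ∈[ a , b ] = a ≤ x × x ≤ b

-- The edges from a vertex to its children on one side, read from the outermost
-- child inwards: in  node s x y  the outermost child has left part x and right
-- part y, and s holds the remaining children.
data Tree : Set where
  leaf : Tree
  node : (s x y : Tree) → Tree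

size degree : Tree → ℕ
size leaf         = 0
size (node s x y) = suc (size s + size x + size y)
degree leaf         = 0
degree (node s x y) = suc (degree s)

-- Rootˡ p a b t: the parent function p, restricted to the vertices in (a,b],
-- is a noncrossing tree on [a,b] with root a and shape t.  Rootʳ is the mirror
-- image, with vertices [a,b) and root b.  The outermost child of the root is c.
data Rootˡ (p : ℕ → ℕ) : ℕ → ℕ → Tree → Set
data Rootʳ (p : ℕ → ℕ) : ℕ → ℕ → Tree → Set

data Rootˡ p where
  leafˡ : ∀ {a} → Rootˡ p a a leaf
  nodeˡ : ∀ {a k c b s x y} →
          Rootˡ p a k s → Rootʳ p (suc k) c x → p c ≡ a → Rootˡ p c b y →
          Rootˡ p a b (node s x y)

data Rootʳ p where
  leafʳ : ∀ {a} → Rootʳ p a a leaf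
  nodeʳ : ∀ {a c k b s x y} →
          Rootʳ p a c x → p c ≡ b → Rootˡ p c k y → Rootʳ p (suc k) b s →
          Rootʳ p a b (node s x y)

module _ {p : ℕ → ℕ} where

  ≤ˡ : ∀ {a b t} → Rootˡ p a b t → a ≤ b
  ≤ʳ : ∀ {a b t} → Rootʳ p a b t → a ≤ b
  ≤ˡ leafˡ = ≤-refl
  ≤ˡ (nodeˡ S X _ Y) = ≤-trans (≤ˡ S) (≤-trans (n≤1+n _) (≤-trans (≤ʳ X) (≤ˡ Y)))
  ≤ʳ leafʳ = ≤-refl
  ≤ʳ (nodeʳ X _ Y S) = ≤-trans (≤ʳ X) (≤-trans (≤ˡ Y) (≤-trans (n≤1+n _) (≤ʳ S)))

  -- Forces the split points of two representations of one shape with the same left end to coincide,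
  -- as `agreeˡ` needs.
  sizeˡ : ∀ {a b t} → Rootˡ p a b t → b ≡ size t + a
  sizeʳ : ∀ {a b t} → Rootʳ p a b t → b ≡ size t + a
  sizeˡ leafˡ = refl
  sizeˡ {a} (nodeˡ {s = s} {x} {y} S X _ Y) rewrite sizeˡ Y | sizeʳ X | sizeˡ S =
    solve 4 (λ a s x y → y :+ (x :+ (con 1 :+ (s :+ a))) := con 1 :+ (s :+ x :+ y) :+ a)
      refl a (size s) (size x) (size y)
    where open +-*-Solver
  sizeʳ leafʳ = refl
  sizeʳ {a} (nodeʳ {s = s} {x} {y} X _ Y S) rewrite sizeʳ S | sizeˡ Y | sizeʳ X =
    solve 4 (λ a s x y → s :+ (con 1 :+ (y :+ (x :+ a))) := con 1 :+ (s :+ x :+ y) :+ a)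
      refl a (size s) (size x) (size y)
    where open +-*-Solver

-- Shape and parent function determine each other on an interval

data Positionˡ (k c x : ℕ) : Set where
  inSiblings : x ≤ k → Positionˡ k c x
  inLeft     : x ∈[ suc k , c ⟩ → Positionˡ k c x
  atChild    : x ≡ c → Positionˡ k c x
  inRight    : c < x → Positionˡ k c x

positionˡ : ∀ k c x → Positionˡ k c x
positionˡ k c x with x ≤? k | <-cmp x c
... | yes x≤k | _            = inSiblings x≤k
... | no  x≰k | tri< x<c _ _ = inLeft (≰⇒> x≰k , x<c)
... | no  _   | tri≈ _ x≡c _ = atChild x≡c
... | no  _   | tri> _ _ c<x = inRight c<x

data Positionʳ (c k x : ℕ) : Set where
  inLeft     : x < c → Positionʳ c k x
  atChild    : x ≡ c → Positionʳ c k x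
  inRight    : x ∈⟨ c , k ] → Positionʳ c k x
  inSiblings : k < x → Positionʳ c k x

positionʳ : ∀ c k x → Positionʳ c k x
positionʳ c k x with x ≤? k | <-cmp x c
... | no  x≰k | _            = inSiblings (≰⇒> x≰k)
... | yes _   | tri< x<c _ _ = inLeft x<c
... | yes _   | tri≈ _ x≡c _ = atChild x≡c
... | yes x≤k | tri> _ _ c<x = inRight (c<x , x≤k)

module _ {p : ℕ → ℕ} where

  closedˡ : ∀ {a b t x} → Rootˡ p a b t → x ∈⟨ a , b ] → p x ∈[ a , b ]
  closedʳ : ∀ {a b t x} → Rootʳ p a b t → x ∈[ a , b ⟩ → p x ∈[ a , b ]
  closedˡ leafˡ (a<x , x≤a) = contradiction x≤a (<⇒≱ a<x)
  closedˡ {x = x} (nodeˡ {a} {k} {c} {b} S X pc Y) (a<x , x≤b) with positionˡ k c x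
  ... | inSiblings x≤k = let l , u = closedˡ S (a<x , x≤k) in
                         l , ≤-trans u (≤-trans (<⇒≤ (≤ʳ X)) (≤ˡ Y))
  ... | inLeft x∈      = let l , u = closedʳ X x∈ in
                         ≤-trans (≤-trans (≤ˡ S) (n≤1+n _)) l , ≤-trans u (≤ˡ Y)
  ... | atChild refl   = ≤-reflexive (sym pc) , subst (_≤ b) (sym pc) (≤-trans (<⇒≤ a<x) x≤b)
  ... | inRight c<x    = let l , u = closedˡ Y (c<x , x≤b) in
                         ≤-trans (≤-trans (≤ˡ S) (<⇒≤ (≤ʳ X))) l , u
  closedʳ leafʳ (a≤x , x<a) = contradiction a≤x (<⇒≱ x<a)
  closedʳ {x = x} (nodeʳ {a} {c} {k} {b} X pc Y S) (a≤x , x<b) with positionʳ c k x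
  ... | inLeft x<c     = let l , u = closedʳ X (a≤x , x<c) in
                         l , ≤-trans u (≤-trans (≤ˡ Y) (<⇒≤ (≤ʳ S)))
  ... | atChild refl   = subst (a ≤_) (sym pc) (≤-trans a≤x (<⇒≤ x<b)) , ≤-reflexive pc
  ... | inRight x∈     = let l , u = closedˡ Y x∈ in
                         ≤-trans (≤ʳ X) l , ≤-trans u (<⇒≤ (≤ʳ S))
  ... | inSiblings k<x = let l , u = closedʳ S (k<x , x<b) in
                         ≤-trans (≤-trans (≤ʳ X) (≤-trans (≤ˡ Y) (n≤1+n _))) l , u

  -- The edge from the outermost child `c` to `b` passes over every gap from `c` on; an earlier gap
  -- lies in the part rooted at `c`.
  gap : ∀ {a b t k} → Rootʳ p a b t → k ∈[ a , b ⟩ → ∃ λ x → x ∈[ a , k ] × k < p x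
  gap leafʳ (a≤k , k<a) = contradiction a≤k (<⇒≱ k<a)
  gap {k = k} (nodeʳ {c = c} X pc Y S) (a≤k , k<b) with k <? c
  ... | yes k<c = gap X (a≤k , k<c)
  ... | no  k≮c = c , (≤ʳ X , ≮⇒≥ k≮c) , subst (k <_) (sym pc) k<b

  -- The sibling part ends at k and the child's part begins at suc k; k cannot be
  -- moved to the right, as the child's part has an edge over every later gap.
  boundary-≤ : ∀ {d e k k′ s x} → Rootʳ p (suc k) e x → Rootˡ p d k′ s →
               d ≤ k → k′ < e → k′ ≤ k
  boundary-≤ {k = k} {k′} X S d≤k k′<e with k′ ≤? k
  ... | yes k′≤k = k′≤k
  ... | no  k′≰k =
    let z , (k<z , z≤k′) , k′<pz = gap X (≰⇒> k′≰k , k′<e)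
    in contradiction (proj₂ (closedˡ S (≤-<-trans d≤k k<z , z≤k′))) (<⇒≱ k′<pz)

  -- A vertex beyond `c` belongs to the part rooted at `c`, where no parent is as small as `a`.
  outermostˡ : ∀ {a b c c′ y} → Rootˡ p c b y → a < c → p c′ ≡ a → c′ ≤ b → c′ ≤ c
  outermostˡ {c = c} {c′} Y a<c refl c′≤b with c′ ≤? c
  ... | yes c′≤c = c′≤c
  ... | no  c′≰c = contradiction (proj₁ (closedˡ Y (≰⇒> c′≰c , c′≤b))) (<⇒≱ a<c)

  outermostʳ : ∀ {a b c c′ x} → Rootʳ p a c x → c < b → p c′ ≡ b → a ≤ c′ → c ≤ c′
  outermostʳ {c = c} {c′} X c<b refl a≤c′ with c ≤? c′
  ... | yes c≤c′ = c≤c′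
  ... | no  c≰c′ = contradiction (proj₂ (closedʳ X (a≤c′ , ≰⇒> c≰c′))) (<⇒≱ c<b)

  -- Both split points can be read off `p`: each of two candidates for `c` bounds the other by
  -- `outermostˡ`, and each of two candidates for `k` bounds the other by `boundary-≤`.
  shape-uniqueˡ : ∀ {a b t t′} → Rootˡ p a b t → Rootˡ p a b t′ → t ≡ t′
  shape-uniqueʳ : ∀ {a b t t′} → Rootʳ p a b t → Rootʳ p a b t′ → t ≡ t′
  shape-uniqueˡ leafˡ leafˡ = refl
  shape-uniqueˡ leafˡ (nodeˡ S X _ Y) =
    contradiction (≤-trans (≤ʳ X) (≤ˡ Y)) (≤⇒≯ (≤ˡ S))
  shape-uniqueˡ (nodeˡ S X _ Y) leafˡ =
    contradiction (≤-trans (≤ʳ X) (≤ˡ Y)) (≤⇒≯ (≤ˡ S))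
  shape-uniqueˡ (nodeˡ S X pc Y) (nodeˡ S′ X′ pc′ Y′)
    with refl ← ≤-antisym (outermostˡ Y′ (≤-<-trans (≤ˡ S′) (≤ʳ X′)) pc (≤ˡ Y))
                          (outermostˡ Y (≤-<-trans (≤ˡ S) (≤ʳ X)) pc′ (≤ˡ Y′))
    with refl ← ≤-antisym (boundary-≤ X′ S (≤ˡ S′) (≤ʳ X)) (boundary-≤ X S′ (≤ˡ S) (≤ʳ X′))
    with refl ← shape-uniqueˡ S S′ | refl ← shape-uniqueʳ X X′ | refl ← shape-uniqueˡ Y Y′
    = refl
  shape-uniqueʳ leafʳ leafʳ = refl
  shape-uniqueʳ leafʳ (nodeʳ X _ Y S) =
    contradiction (≤-trans (≤ʳ X) (≤ˡ Y)) (<⇒≱ (≤ʳ S))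
  shape-uniqueʳ (nodeʳ X _ Y S) leafʳ =
    contradiction (≤-trans (≤ʳ X) (≤ˡ Y)) (<⇒≱ (≤ʳ S))
  shape-uniqueʳ (nodeʳ X pc Y S) (nodeʳ X′ pc′ Y′ S′)
    with refl ← ≤-antisym (outermostʳ X (≤-<-trans (≤ˡ Y) (≤ʳ S)) pc′ (≤ʳ X′))
                          (outermostʳ X′ (≤-<-trans (≤ˡ Y′) (≤ʳ S′)) pc (≤ʳ X))
    with refl ← ≤-antisym (boundary-≤ S′ Y (≤ˡ Y′) (≤ʳ S)) (boundary-≤ S Y′ (≤ˡ Y) (≤ʳ S′))
    with refl ← shape-uniqueʳ S S′ | refl ← shape-uniqueʳ X X′ | refl ← shape-uniqueˡ Y Y′
    = refl

module _ {p q : ℕ → ℕ} where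

  agreeˡ : ∀ {a b t x} → Rootˡ p a b t → Rootˡ q a b t → x ∈⟨ a , b ] → p x ≡ q x
  agreeʳ : ∀ {a b t x} → Rootʳ p a b t → Rootʳ q a b t → x ∈[ a , b ⟩ → p x ≡ q x
  agreeˡ leafˡ leafˡ (a<x , x≤a) = contradiction x≤a (<⇒≱ a<x)
  agreeˡ {x = x} (nodeˡ {k = k} {c} S X pc Y) (nodeˡ S′ X′ qc Y′) (a<x , x≤b)
    with refl ← trans (sizeˡ S) (sym (sizeˡ S′))
    with refl ← trans (sizeʳ X) (sym (sizeʳ X′))
    with positionˡ k c x
  ... | inSiblings x≤k = agreeˡ S S′ (a<x , x≤k)
  ... | inLeft x∈      = agreeʳ X X′ x∈
  ... | atChild refl   = trans pc (sym qc)
  ... | inRight c<x    = agreeˡ Y Y′ (c<x , x≤b)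
  agreeʳ leafʳ leafʳ (a≤x , x<a) = contradiction a≤x (<⇒≱ x<a)
  agreeʳ {x = x} (nodeʳ {c = c} {k} X pc Y S) (nodeʳ X′ qc Y′ S′) (a≤x , x<b)
    with refl ← trans (sizeʳ X) (sym (sizeʳ X′))
    with refl ← trans (sizeˡ Y) (sym (sizeˡ Y′))
    with positionʳ c k x
  ... | inLeft x<c     = agreeʳ X X′ (a≤x , x<c)
  ... | atChild refl   = trans pc (sym qc)
  ... | inRight x∈     = agreeˡ Y Y′ x∈
  ... | inSiblings k<x = agreeʳ S S′ (k<x , x<b)

  transportˡ : ∀ {a b t} → (∀ {x} → x ∈⟨ a , b ] → p x ≡ q x) → Rootˡ p a b t → Rootˡ q a b t
  transportʳ : ∀ {a b t} → (∀ {x} → x ∈[ a , b ⟩ → p x ≡ q x) → Rootʳ p a b t → Rootʳ q a b t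
  transportˡ _ leafˡ = leafˡ
  transportˡ p≗q (nodeˡ S X pc Y) = nodeˡ
    (transportˡ (λ (l , u) → p≗q (l , ≤-trans u (≤-trans (<⇒≤ (≤ʳ X)) (≤ˡ Y)))) S)
    (transportʳ (λ (l , u) → p≗q (≤-trans (s≤s (≤ˡ S)) l , ≤-trans (<⇒≤ u) (≤ˡ Y))) X)
    (trans (sym (p≗q (≤-<-trans (≤ˡ S) (≤ʳ X) , ≤ˡ Y))) pc)
    (transportˡ (λ (l , u) → p≗q (≤-<-trans (≤-trans (≤ˡ S) (<⇒≤ (≤ʳ X))) l , u)) Y)
  transportʳ _ leafʳ = leafʳ
  transportʳ p≗q (nodeʳ X pc Y S) = nodeʳ
    (transportʳ (λ (l , u) → p≗q (l , <-≤-trans u (≤-trans (≤ˡ Y) (<⇒≤ (≤ʳ S))))) X)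
    (trans (sym (p≗q (≤ʳ X , ≤-<-trans (≤ˡ Y) (≤ʳ S)))) pc)
    (transportˡ (λ (l , u) → p≗q (≤-trans (≤ʳ X) (<⇒≤ l) , ≤-<-trans u (≤ʳ S))) Y)
    (transportʳ (λ (l , u) → p≗q (≤-trans (≤ʳ X) (≤-trans (≤ˡ Y) (<⇒≤ l)) , u)) S)

-- Every shape has a parent function

splice : ℕ → (p q : ℕ → ℕ) → ℕ → ℕ
splice m p q x with x <? m
... | yes _ = p x
... | no  _ = q x

splice-< : ∀ {m x} p q → x < m → splice m p q x ≡ p x
splice-< {m} {x} p q x<m with x <? m
... | yes _   = refl
... | no  x≮m = contradiction x<m x≮m

splice-≥ : ∀ {m x} p q → m ≤ x → splice m p q x ≡ q x
splice-≥ {m} {x} p q m≤x with x <? m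
... | yes x<m = contradiction m≤x (<⇒≱ x<m)
... | no  _   = refl

-- Each part constrains the parent function only on its own interval, so the pieces are glued by
-- position. The right end is an output because it depends on the size of the shape.
realiseˡ : ∀ t a → ∃₂ λ p b → Rootˡ p a b t
realiseʳ : ∀ t a → ∃₂ λ p b → Rootʳ p a b t
realiseˡ leaf a = (λ _ → 0) , a , leafˡ
realiseˡ (node s x y) a =
  let p₁ , k , S = realiseˡ s a
      p₂ , c , X = realiseʳ x (suc k)
      p₄ , b , Y = realiseˡ y c
      p₃ = λ _ → a
      r₃ = splice (suc c) p₃ p₄
      r₂ = splice c p₂ r₃
      r₁ = splice (suc k) p₁ r₂
      k<c = ≤ʳ X
  in r₁ , b , nodeˡ
    (transportˡ (λ (_ , u) → sym (splice-< p₁ r₂ (s≤s u))) S)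
    (transportʳ (λ (l , u) → sym (trans (splice-≥ p₁ r₂ l) (splice-< p₂ r₃ u))) X)
    (trans (splice-≥ p₁ r₂ k<c)
           (trans (splice-≥ {c} {c} p₂ r₃ ≤-refl) (splice-< {suc c} {c} p₃ p₄ ≤-refl)))
    (transportˡ (λ (l , u) → sym (trans (splice-≥ p₁ r₂ (≤-trans k<c (<⇒≤ l)))
                                 (trans (splice-≥ p₂ r₃ (<⇒≤ l)) (splice-≥ p₃ p₄ l)))) Y)
realiseʳ leaf a = (λ _ → 0) , a , leafʳ
realiseʳ (node s x y) a =
  let p₁ , c , X = realiseʳ x a
      p₃ , k , Y = realiseˡ y c
      p₄ , b , S = realiseʳ s (suc k)
      -- Here the root is the right end, so the parent of `c` is known only once the siblings have
      -- been laid out.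
      p₂ = λ _ → b
      r₃ = splice (suc k) p₃ p₄
      r₂ = splice (suc c) p₂ r₃
      r₁ = splice c p₁ r₂
      c≤k = ≤ˡ Y
  in r₁ , b , nodeʳ
    (transportʳ (λ (_ , u) → sym (splice-< p₁ r₂ u)) X)
    (trans (splice-≥ {c} {c} p₁ r₂ ≤-refl) (splice-< {suc c} {c} p₂ r₃ ≤-refl))
    (transportˡ (λ (l , u) → sym (trans (splice-≥ p₁ r₂ (<⇒≤ l))
                                 (trans (splice-≥ p₂ r₃ l) (splice-< p₃ p₄ (s≤s u))))) Y)
    (transportʳ (λ (l , u) → sym (trans (splice-≥ p₁ r₂ (≤-trans c≤k (<⇒≤ l)))
                                 (trans (splice-≥ p₂ r₃ (≤-trans (s≤s c≤k) l)) (splice-≥ p₃ p₄ l)))) S)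

-- Noncrossing edges

-- One of the two alternatives of `crossᵇ`, the one where the first chord starts first; the other is
-- obtained by exchanging the chords.
Crosses : (a b c d : ℕ) → Set
Crosses a b c d = (a ⊓ b < c ⊓ d) × (c ⊓ d < a ⊔ b) × (a ⊔ b < c ⊔ d)

EdgesCross : (ℕ → ℕ) → ℕ → ℕ → Set
EdgesCross p x y = Crosses x (p x) y (p y)

disjoint⇒¬Crosses : ∀ {a b c d} → a ⊔ b ≤ c ⊓ d → ¬ Crosses a b c d
disjoint⇒¬Crosses h (_ , c<b , _) = <⇒≱ c<b h

lower⇒¬Crosses : ∀ {a b c d} → c ⊓ d ≤ a ⊓ b → ¬ Crosses a b c d
lower⇒¬Crosses h (a<c , _ , _) = <⇒≱ a<c h

upper⇒¬Crosses : ∀ {a b c d} → c ⊔ d ≤ a ⊔ b → ¬ Crosses a b c d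
upper⇒¬Crosses h (_ , _ , b<d) = <⇒≱ b<d h

crosses-leftwards : ∀ {s t u w} → t < u → u < s → s < w → Crosses s t u w
crosses-leftwards {s} {t} {u} {w} t<u u<s s<w =
  ≤-<-trans (m⊓n≤n s t) (⊓-glb t<u (<-trans t<u u<w)) ,
  ≤-<-trans (m⊓n≤m u w) (<-≤-trans u<s (m≤m⊔n s t)) ,
  <-≤-trans (⊔-lub s<w (<-trans t<u u<w)) (m≤n⊔m u w)
  where u<w = <-trans u<s s<w

crosses-rightwards : ∀ {s t u w} → u < s → s < w → w < t → Crosses u w s t
crosses-rightwards {s} {t} {u} {w} u<s s<w w<t =
  ≤-<-trans (m⊓n≤m u w) (⊓-glb u<s (<-trans u<w w<t)) ,
  ≤-<-trans (m⊓n≤m s t) (<-≤-trans s<w (m≤n⊔m u w)) ,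
  <-≤-trans (⊔-lub (<-trans u<w w<t) w<t) (m≤n⊔m s t)
  where u<w = <-trans u<s s<w

Crosses-swapˡ : ∀ a b {c d} → Crosses a b c d → Crosses b a c d
Crosses-swapˡ a b rewrite ⊓-comm a b | ⊔-comm a b = λ h → h

Crosses-swapʳ : ∀ {a b} c d → Crosses a b c d → Crosses a b d c
Crosses-swapʳ c d rewrite ⊓-comm c d | ⊔-comm c d = λ h → h

-- The first index mirrors the fuel of `reachesRoot`: `here` accepts any value, so it bounds the
-- number of steps rather than counting them.
data Reaches (p : ℕ → ℕ) (r : ℕ) : ℕ → ℕ → Set where
  here : ∀ {m} → Reaches p r m r
  step : ∀ {m x} → Reaches p r m (p x) → Reaches p r (suc m) x

module _ {p : ℕ → ℕ} where

  Reaches-∷ʳ : ∀ {r r′ m x} → p r ≡ r′ → Reaches p r m x → Reaches p r′ (suc m) x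
  Reaches-∷ʳ refl here     = step here
  Reaches-∷ʳ eq   (step h) = step (Reaches-∷ʳ eq h)

  -- The length of the interval suffices as a bound: the parts around `c` are shorter by at least
  -- one, which pays for the last step from `c` to the root, while the siblings keep the root and
  -- need no extra step.
  reachesˡ : ∀ {a b t x} m → Rootˡ p a b t → b ≤ m + a → x ∈⟨ a , b ] → Reaches p a m x
  reachesʳ : ∀ {a b t x} m → Rootʳ p a b t → b ≤ m + a → x ∈[ a , b ⟩ → Reaches p b m x
  reachesˡ zero _ b≤a (a<x , x≤b) = contradiction (≤-trans x≤b b≤a) (<⇒≱ a<x)
  reachesˡ (suc m) leafˡ _ (a<x , x≤a) = contradiction x≤a (<⇒≱ a<x)
  reachesˡ {x = x} (suc m) (nodeˡ {a} {k} {c} S X pc Y) b≤ (a<x , x≤b) with positionˡ k c x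
  ... | inSiblings x≤k = reachesˡ (suc m) S (≤-trans (≤-trans (<⇒≤ (≤ʳ X)) (≤ˡ Y)) b≤) (a<x , x≤k)
  ... | inLeft x∈      = Reaches-∷ʳ pc (reachesʳ m X
      (≤-trans (≤ˡ Y) (≤-trans b≤ (≤-trans (s≤s (+-monoʳ-≤ m (≤ˡ S))) (≤-reflexive (sym (+-suc m k)))))) x∈)
  ... | atChild refl   = Reaches-∷ʳ pc here
  ... | inRight c<x    = Reaches-∷ʳ pc (reachesˡ m Y
      (≤-trans b≤ (≤-trans (≤-reflexive (sym (+-suc m a))) (+-monoʳ-≤ m (≤-<-trans (≤ˡ S) (≤ʳ X))))) (c<x , x≤b))
  reachesʳ zero _ b≤a (a≤x , x<b) = contradiction (≤-trans b≤a a≤x) (<⇒≱ x<b)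
  reachesʳ (suc m) leafʳ _ (a≤x , x<a) = contradiction a≤x (<⇒≱ x<a)
  reachesʳ {x = x} (suc m) (nodeʳ {a} {c} {k} X pc Y S) b≤ (a≤x , x<b) with positionʳ c k x
  ... | inLeft x<c     = Reaches-∷ʳ pc (reachesʳ m X
      (≤-pred (≤-trans (≤-<-trans (≤ˡ Y) (≤ʳ S)) b≤)) (a≤x , x<c))
  ... | atChild refl   = Reaches-∷ʳ pc here
  ... | inRight x∈     = Reaches-∷ʳ pc (reachesˡ m Y
      (≤-trans (≤-pred (≤-trans (≤ʳ S) b≤)) (+-monoʳ-≤ m (≤ʳ X))) x∈)
  ... | inSiblings k<x = reachesʳ (suc m) S
      (≤-trans b≤ (+-monoʳ-≤ (suc m) (≤-trans (≤ʳ X) (≤-trans (≤ˡ Y) (n≤1+n k))))) (k<x , x<b)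

  Spans : ℕ → ℕ → ℕ → Set
  Spans a b x = a ≤ x ⊓ p x × x ⊔ p x ≤ b

  spanˡ : ∀ {a b t x} → Rootˡ p a b t → x ∈⟨ a , b ] → Spans a b x
  spanˡ r x∈@(l , u) = let l′ , u′ = closedˡ r x∈ in ⊓-glb (<⇒≤ l) l′ , ⊔-lub u u′

  spanʳ : ∀ {a b t x} → Rootʳ p a b t → x ∈[ a , b ⟩ → Spans a b x
  spanʳ r x∈@(l , u) = let l′ , u′ = closedʳ r x∈ in ⊓-glb l l′ , ⊔-lub (<⇒≤ u) u′

  before : ∀ {a b c d x y} → Spans a b x → Spans c d y → b ≤ c → ¬ EdgesCross p x y
  before (_ , u) (l , _) b≤c = disjoint⇒¬Crosses (≤-trans u (≤-trans b≤c l))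

  after : ∀ {a b c d x y} → Spans a b x → Spans c d y → d ≤ a → ¬ EdgesCross p x y
  after {y = y} (l , _) (_ , u) d≤a =
    lower⇒¬Crosses (≤-trans (≤-trans (m⊓n≤m y _) (m≤m⊔n y _)) (≤-trans u (≤-trans d≤a l)))

  -- The three parts occupy consecutive intervals sharing at most an endpoint. The edge between `c`
  -- and the root spans two of them and meets the third only at `c`.
  noncrossingˡ : ∀ {a b t x y} → Rootˡ p a b t → x ∈⟨ a , b ] → y ∈⟨ a , b ] → ¬ EdgesCross p x y
  noncrossingʳ : ∀ {a b t x y} → Rootʳ p a b t → x ∈[ a , b ⟩ → y ∈[ a , b ⟩ → ¬ EdgesCross p x y
  noncrossingˡ leafˡ (a<x , x≤a) _ = contradiction x≤a (<⇒≱ a<x)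
  noncrossingˡ {x = x} {y} r@(nodeˡ {a} {k} {c} {b} S X pc Y) x∈@(a<x , x≤b) y∈@(a<y , y≤b)
    with positionˡ k c x | positionˡ k c y
  ... | _ | atChild refl =
    lower⇒¬Crosses (≤-trans (m⊓n≤n c (p c)) (subst (_≤ x ⊓ p x) (sym pc) (proj₁ (spanˡ r x∈))))
  ... | inSiblings x≤k | inSiblings y≤k = noncrossingˡ S (a<x , x≤k) (a<y , y≤k)
  ... | inSiblings x≤k | inLeft y∈X     = before (spanˡ S (a<x , x≤k)) (spanʳ X y∈X) (n≤1+n k)
  ... | inSiblings x≤k | inRight c<y    =
    before (spanˡ S (a<x , x≤k)) (spanˡ Y (c<y , y≤b)) (<⇒≤ (≤ʳ X))
  ... | inLeft x∈X | inSiblings y≤k = after (spanʳ X x∈X) (spanˡ S (a<y , y≤k)) (n≤1+n k)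
  ... | inLeft x∈X | inLeft y∈X     = noncrossingʳ X x∈X y∈X
  ... | inLeft x∈X | inRight c<y    = before (spanʳ X x∈X) (spanˡ Y (c<y , y≤b)) ≤-refl
  ... | atChild refl | inSiblings y≤k = upper⇒¬Crosses
    (≤-trans (proj₂ (spanˡ S (a<y , y≤k))) (≤-trans (<⇒≤ (≤ʳ X)) (m≤m⊔n c _)))
  ... | atChild refl | inLeft y∈X     =
    upper⇒¬Crosses (≤-trans (proj₂ (spanʳ X y∈X)) (m≤m⊔n c _))
  ... | atChild refl | inRight c<y    = disjoint⇒¬Crosses
    (≤-trans (⊔-lub ≤-refl (≤-trans (≤-reflexive pc) (<⇒≤ a<x))) (proj₁ (spanˡ Y (c<y , y≤b))))
  ... | inRight c<x | inSiblings y≤k =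
    after (spanˡ Y (c<x , x≤b)) (spanˡ S (a<y , y≤k)) (<⇒≤ (≤ʳ X))
  ... | inRight c<x | inLeft y∈X  = after (spanˡ Y (c<x , x≤b)) (spanʳ X y∈X) ≤-refl
  ... | inRight c<x | inRight c<y = noncrossingˡ Y (c<x , x≤b) (c<y , y≤b)
  noncrossingʳ leafʳ (a≤x , x<a) _ = contradiction a≤x (<⇒≱ x<a)
  noncrossingʳ {x = x} {y} r@(nodeʳ {a} {c} {k} {b} X pc Y S) x∈@(a≤x , x<b) y∈@(a≤y , y<b)
    with positionʳ c k x | positionʳ c k y
  ... | atChild refl | _ =
    upper⇒¬Crosses (≤-trans (proj₂ (spanʳ r y∈)) (≤-trans (≤-reflexive (sym pc)) (m≤n⊔m c _)))
  ... | inLeft x<c | inLeft y<c = noncrossingʳ X (a≤x , x<c) (a≤y , y<c)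
  ... | inLeft x<c | atChild refl = disjoint⇒¬Crosses
    (≤-trans (proj₂ (spanʳ X (a≤x , x<c))) (⊓-glb ≤-refl (≤-trans (<⇒≤ y<b) (≤-reflexive (sym pc)))))
  ... | inLeft x<c | inRight y∈Y = before (spanʳ X (a≤x , x<c)) (spanˡ Y y∈Y) ≤-refl
  ... | inLeft x<c | inSiblings k<y =
    before (spanʳ X (a≤x , x<c)) (spanʳ S (k<y , y<b)) (≤-trans (≤ˡ Y) (n≤1+n k))
  ... | inRight x∈Y | inLeft y<c = after (spanˡ Y x∈Y) (spanʳ X (a≤y , y<c)) ≤-refl
  ... | inRight x∈Y | atChild refl =
    lower⇒¬Crosses (≤-trans (m⊓n≤m c _) (proj₁ (spanˡ Y x∈Y)))
  ... | inRight x∈Y | inRight y∈Y = noncrossingˡ Y x∈Y y∈Y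
  ... | inRight x∈Y | inSiblings k<y = before (spanˡ Y x∈Y) (spanʳ S (k<y , y<b)) (n≤1+n k)
  ... | inSiblings k<x | inLeft y<c =
    after (spanʳ S (k<x , x<b)) (spanʳ X (a≤y , y<c)) (≤-trans (≤ˡ Y) (n≤1+n k))
  ... | inSiblings k<x | atChild refl = lower⇒¬Crosses
    (≤-trans (m⊓n≤m c _) (≤-trans (≤-trans (≤ˡ Y) (n≤1+n k)) (proj₁ (spanʳ S (k<x , x<b)))))
  ... | inSiblings k<x | inRight y∈Y = after (spanʳ S (k<x , x<b)) (spanˡ Y y∈Y) (n≤1+n k)
  ... | inSiblings k<x | inSiblings k<y = noncrossingʳ S (k<x , x<b) (k<y , y<b)

-- Recovering the shape from a noncrossing parent function

module _ {P : ℕ → Set} (P? : Decidable P) where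

  greatest : ∀ {x} b → x ≤ b → P x → ∃ λ c → c ≤ b × P c × (∀ {y} → y ∈⟨ c , b ] → ¬ P y)
  greatest zero z≤n Px = 0 , ≤-refl , Px , λ (l , u) → contradiction u (<⇒≱ l)
  greatest (suc b) x≤1+b Px with P? (suc b)
  ... | yes Pb = suc b , ≤-refl , Pb , λ (l , u) → contradiction u (<⇒≱ l)
  ... | no ¬Pb with m≤n⇒m<n∨m≡n x≤1+b
  ...   | inj₂ refl = contradiction Px ¬Pb
  ...   | inj₁ (s≤s x≤b) with greatest b x≤b Px
  ...     | c , c≤b , Pc , max = c , ≤-trans c≤b (n≤1+n b) , Pc , max′
    where
    max′ : ∀ {y} → y ∈⟨ c , suc b ] → ¬ P y
    max′ (l , u) with m≤n⇒m<n∨m≡n u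
    ... | inj₁ (s≤s y≤b) = max (l , y≤b)
    ... | inj₂ refl      = ¬Pb

module _ {P : ℕ → Set} (P? : Decidable P) where

  least : ∀ {x} m → x ≤ m → P x → ∃ λ c → P c × (∀ {y} → y < c → ¬ P y)
  least zero z≤n Px = 0 , Px , λ ()
  least {x} (suc m) x≤1+m Px with anyUpTo? P? x
  ... | no ∄                = x , Px , λ y<x Py → ∄ (_ , y<x , Py)
  ... | yes (y , y<x , Py)  = least m (≤-pred (≤-trans y<x x≤1+m)) Py

module Decode (p : ℕ → ℕ) (N : ℕ)
  (noncrossing : ∀ {x y} → x ∈⟨ 1 , N ] → y ∈⟨ 1 , N ] → ¬ EdgesCross p x y)
  (reaches : ∀ {x} → x ∈⟨ 1 , N ] → ∃ λ m → Reaches p 1 m x)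
  where

  EdgeBetween : ℕ → ℕ → ℕ → Set
  EdgeBetween x u w = (x ≡ u × p x ≡ w) ⊎ (x ≡ w × p x ≡ u)

  EdgesCross-between : ∀ {x y s t u w} → EdgeBetween x u w → EdgeBetween y s t →
                       Crosses u w s t → EdgesCross p x y
  EdgesCross-between (inj₁ (refl , refl)) (inj₁ (refl , refl)) = λ cr → cr
  EdgesCross-between (inj₁ (refl , refl)) (inj₂ (refl , refl)) = Crosses-swapʳ _ _
  EdgesCross-between (inj₂ (refl , refl)) (inj₁ (refl , refl)) = Crosses-swapˡ _ _
  EdgesCross-between (inj₂ (refl , refl)) (inj₂ (refl , refl)) =
    λ cr → Crosses-swapˡ _ _ (Crosses-swapʳ _ _ cr)

  -- With `s` strictly under the chord from `u` to `w`, an endpoint `t` outside it would make the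
  -- two edges interleave, on the left or on the right.
  enclosed : ∀ {x y s t u w} → x ∈⟨ 1 , N ] → y ∈⟨ 1 , N ] →
             EdgeBetween x u w → EdgeBetween y s t → u < s → s < w → t ∈[ u , w ]
  enclosed {x} {y} x∈ y∈ e f u<s s<w =
    ≮⇒≥ (λ t<u → noncrossing y∈ x∈ (EdgesCross-between {y} {x} f e (crosses-leftwards t<u u<s s<w))) ,
    ≮⇒≥ (λ w<t → noncrossing x∈ y∈ (EdgesCross-between {x} {y} e f (crosses-rightwards u<s s<w w<t)))

  -- The path from `x` to the vertex 1 stays in the interval until it meets `a`, because 1 is not in
  -- `(a, b]`; the vertex just before `a` is the child.
  childˡ : ∀ {m a b x} → 1 ≤ a → Reaches p 1 m x → x ∈⟨ a , b ] →
           (∀ {y} → y ∈⟨ a , b ] → p y ∈[ a , b ]) → ∃ λ c → c ∈⟨ a , b ] × p c ≡ a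
  childˡ 1≤a here (a<1 , _) _ = contradiction 1≤a (<⇒≱ a<1)
  childˡ 1≤a (step h) x∈ closed with closed x∈
  ... | a≤px , px≤b with m≤n⇒m<n∨m≡n a≤px
  ...   | inj₁ a<px = childˡ 1≤a h (a<px , px≤b) closed
  ...   | inj₂ a≡px = _ , x∈ , sym a≡px

  childʳ : ∀ {m a b x} → 1 < a → Reaches p 1 m x → x ∈[ a , b ⟩ →
           (∀ {y} → y ∈[ a , b ⟩ → p y ∈[ a , b ]) → ∃ λ c → c ∈[ a , b ⟩ × p c ≡ b
  childʳ 1<a here (a≤1 , _) _ = contradiction a≤1 (<⇒≱ 1<a)
  childʳ 1<a (step h) x∈ closed with closed x∈
  ... | a≤px , px≤b with m≤n⇒m<n∨m≡n px≤b
  ...   | inj₁ px<b = childʳ 1<a h (a≤px , px<b) closed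
  ...   | inj₂ px≡b = _ , x∈ , px≡b

  -- The boundary between two neighbouring parts is not recorded in `p`. It is reconstructed as the
  -- end of the longest prefix, short of `c`, that no edge leaves to the right; an edge coming back
  -- from beyond would yield a longer one.
  separate : ∀ {a c} → 1 ≤ a → a < c → c ≤ N →
             (∀ {y} → a < y → y < c → p y ∈[ a , c ]) →
             ∃ λ k → a ≤ k × k < c × (∀ {y} → y ∈⟨ a , k ] → p y ∈[ a , k ])
                   × (∀ {y} → y ∈[ suc k , c ⟩ → p y ∈[ suc k , c ])
  separate {a} {suc c′} 1≤a (s≤s a≤c′) c≤N closed
    -- The search starts from the empty prefix `k = a` and stops at `c - 1`, which keeps `c` out of
    -- the prefix.
    with greatest Closed? c′ a≤c′ (≤-refl , λ { (s≤s y≤a) a<y → contradiction y≤a (<⇒≱ a<y) })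
    where
    Closed : ℕ → Set
    Closed k = a ≤ k × (∀ {y} → y < suc k → a < y → p y ≤ k)
    Closed? : Decidable Closed
    Closed? k = (a ≤? k) ×-dec allUpTo? (λ y → (a <? y) →-dec (p y ≤? k)) (suc k)
  ... | k , k≤c′ , (a≤k , below) , maximal =
    k , a≤k , s≤s k≤c′ ,
    (λ { (a<y , y≤k) → proj₁ (closed a<y (≤-trans (s≤s y≤k) (s≤s k≤c′))) , below (s≤s y≤k) a<y }) ,
    (λ { (k<y , y<c) → ≰⇒> (λ py≤k → maximal (k<y , ≤-pred y<c) (extends k<y y<c py≤k)) ,
                       proj₂ (closed (≤-<-trans a≤k k<y) y<c) })
    where
    -- An edge from x > k to a vertex ≤ k encloses all of (k,x), so the prefix up to x is closed too.
    extends : ∀ {x} → k < x → x < suc c′ → p x ≤ k →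
              a ≤ x × (∀ {y} → y < suc x → a < y → p y ≤ x)
    extends {x} k<x x<c px≤k = <⇒≤ a<x , closed-to-x
      where
      a<x = ≤-<-trans a≤k k<x
      vertex : ∀ {y} → a < y → y ≤ x → y ∈⟨ 1 , N ]
      vertex a<y y≤x = ≤-<-trans 1≤a a<y , ≤-trans (<⇒≤ (≤-<-trans y≤x x<c)) c≤N
      closed-to-x : ∀ {y} → y < suc x → a < y → p y ≤ x
      closed-to-x {y} (s≤s y≤x) a<y with y ≤? k | m≤n⇒m<n∨m≡n y≤x
      ... | yes y≤k | _         = ≤-trans (below (s≤s y≤k) a<y) (<⇒≤ k<x)
      ... | no _    | inj₂ refl = ≤-trans px≤k (<⇒≤ k<x)
      ... | no y≰k  | inj₁ y<x  = proj₂ (enclosed {x} {y} (vertex a<x ≤-refl) (vertex a<y y≤x)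
        (inj₂ (refl , refl)) (inj₁ (refl , refl)) (≤-<-trans px≤k (≰⇒> y≰k)) y<x)

  -- Closure of the interval under `p` is what the recursion preserves: it passes to each of the
  -- three parts around the outermost child. The length bound `m` makes the recursion structural.
  decodeˡ : ∀ m {a b} → b ≤ m + a → 1 ≤ a → a ≤ b → b ≤ N →
            (∀ {y} → y ∈⟨ a , b ] → p y ∈[ a , b ]) → ∃ (Rootˡ p a b)
  decodeʳ : ∀ m {a b} → b ≤ m + a → 1 < a → a ≤ b → b ≤ N →
            (∀ {y} → y ∈[ a , b ⟩ → p y ∈[ a , b ]) → ∃ (Rootʳ p a b)

  decodeˡ zero b≤a _ a≤b _ _ with refl ← ≤-antisym b≤a a≤b = leaf , leafˡ
  decodeˡ (suc m) {a} {b} b≤ 1≤a a≤b b≤N closed with m≤n⇒m<n∨m≡n a≤b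
  ... | inj₂ refl = leaf , leafˡ
  ... | inj₁ a<b with childˡ 1≤a (proj₂ (reaches (≤-<-trans 1≤a a<b , b≤N))) (a<b , ≤-refl) closed
  ... | c₀ , (a<c₀ , c₀≤b) , pc₀
    with greatest (λ x → (a <? x) ×-dec (p x ≟ a)) b c₀≤b (a<c₀ , pc₀)
  ... | c , c≤b , (a<c , pc) , outermost
    with separate 1≤a a<c (≤-trans c≤b b≤N) closedUnder
    where
    closedUnder : ∀ {y} → a < y → y < c → p y ∈[ a , c ]
    closedUnder {y} a<y y<c = enclosed {c} {y} (≤-<-trans 1≤a a<c , ≤-trans c≤b b≤N)
      (≤-<-trans 1≤a a<y , ≤-trans (<⇒≤ y<c) (≤-trans c≤b b≤N))
      (inj₂ (refl , pc)) (inj₁ (refl , refl)) a<y y<c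
  ... | k , a≤k , k<c , closedS , closedX
    with decodeˡ m (≤-pred (≤-trans k<c (≤-trans c≤b b≤))) 1≤a a≤k (≤-trans (<⇒≤ k<c) (≤-trans c≤b b≤N)) closedS
       | decodeʳ m (≤-trans c≤b (≤-trans b≤ (≤-trans (s≤s (+-monoʳ-≤ m a≤k)) (≤-reflexive (sym (+-suc m k))))))
           (s≤s (≤-trans 1≤a a≤k)) k<c (≤-trans c≤b b≤N) closedX
       | decodeˡ m (≤-trans b≤ (≤-trans (≤-reflexive (sym (+-suc m a))) (+-monoʳ-≤ m a<c)))
           (≤-trans 1≤a (<⇒≤ a<c)) c≤b b≤N closedY
    where
    closedY : ∀ {y} → y ∈⟨ c , b ] → p y ∈[ c , b ]
    closedY {y} (c<y , y≤b) with closed (<-trans a<c c<y , y≤b)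
    ... | a≤py , py≤b = ≮⇒≥ py≮c , py≤b
      where
      y∈ = ≤-<-trans 1≤a (<-trans a<c c<y) , ≤-trans y≤b b≤N
      -- A parent equal to `a` contradicts the choice of `c` as outermost child; a parent strictly
      -- between `a` and `c` gives an edge crossing the one from `c` to `a`.
      py≮c : ¬ (p y < c)
      py≮c py<c with m≤n⇒m<n∨m≡n a≤py
      ... | inj₂ a≡py = outermost (c<y , y≤b) (<-trans a<c c<y , sym a≡py)
      ... | inj₁ a<py = <⇒≱ c<y (proj₂ (enclosed {c} {y} (≤-<-trans 1≤a a<c , ≤-trans c≤b b≤N) y∈
        (inj₂ (refl , pc)) (inj₂ (refl , refl)) a<py py<c))
  ... | _ , S | _ , X | _ , Y = _ , nodeˡ S X pc Y

  decodeʳ zero b≤a _ a≤b _ _ with refl ← ≤-antisym b≤a a≤b = leaf , leafʳ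
  decodeʳ (suc m) {a} {b} b≤ 1<a a≤b b≤N closed with m≤n⇒m<n∨m≡n a≤b
  ... | inj₂ refl = leaf , leafʳ
  ... | inj₁ a<b with childʳ 1<a (proj₂ (reaches (1<a , ≤-trans a≤b b≤N))) (≤-refl , a<b) closed
  ... | c₀ , (a≤c₀ , c₀<b) , pc₀
    with least (λ x → (a ≤? x) ×-dec (x <? b) ×-dec (p x ≟ b)) c₀ ≤-refl (a≤c₀ , c₀<b , pc₀)
  ... | c , (a≤c , c<b , pc) , outermost
    with separate (<⇒≤ (≤-trans 1<a a≤c)) c<b b≤N closedUnder
    where
    closedUnder : ∀ {y} → c < y → y < b → p y ∈[ c , b ]
    closedUnder {y} c<y y<b = enclosed {c} {y} (≤-trans 1<a a≤c , ≤-trans (<⇒≤ c<b) b≤N)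
      (≤-trans 1<a (≤-trans a≤c (<⇒≤ c<y)) , ≤-trans (<⇒≤ y<b) b≤N)
      (inj₁ (refl , pc)) (inj₁ (refl , refl)) c<y y<b
  ... | k , c≤k , k<b , closedY , closedS
    with decodeʳ m (≤-pred (≤-trans c<b b≤)) 1<a a≤c (≤-trans (<⇒≤ c<b) b≤N) closedX
       | decodeˡ m (≤-pred (≤-trans k<b (≤-trans b≤ (s≤s (+-monoʳ-≤ m a≤c)))))
           (<⇒≤ (≤-trans 1<a a≤c)) c≤k (≤-trans (<⇒≤ k<b) b≤N) closedY
       | decodeʳ m (≤-trans b≤ (≤-trans (s≤s (+-monoʳ-≤ m (≤-trans a≤c c≤k))) (≤-reflexive (sym (+-suc m k)))))
           (s≤s (≤-trans (<⇒≤ 1<a) (≤-trans a≤c c≤k))) k<b b≤N closedS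
    where
    closedX : ∀ {y} → y ∈[ a , c ⟩ → p y ∈[ a , c ]
    closedX {y} (a≤y , y<c) with closed (a≤y , <-trans y<c c<b)
    ... | a≤py , py≤b = a≤py , ≮⇒≥ c≮py
      where
      y∈ = ≤-trans 1<a a≤y , ≤-trans (<⇒≤ (<-trans y<c c<b)) b≤N
      c≮py : ¬ (c < p y)
      c≮py c<py with m≤n⇒m<n∨m≡n py≤b
      ... | inj₂ py≡b = outermost y<c (a≤y , <-trans y<c c<b , py≡b)
      ... | inj₁ py<b = <⇒≱ y<c (proj₁ (enclosed {c} {y} (≤-trans 1<a a≤c , ≤-trans (<⇒≤ c<b) b≤N) y∈
        (inj₁ (refl , pc)) (inj₂ (refl , refl)) c<py py<b))
  ... | _ , X | _ , Y | _ , S = _ , nodeʳ X pc Y S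

-- Parent vectors

module _ {A : Set} {f : A → Bool} where

  all-sound : ∀ {xs} → T (all f xs) → ∀ {x} → x ∈ xs → T (f x)
  all-sound h (here refl) = proj₁ (to T-∧ h)
  all-sound h (there x∈)  = all-sound (proj₂ (to T-∧ h)) x∈

  all-complete : ∀ {xs} → (∀ {x} → x ∈ xs → T (f x)) → T (all f xs)
  all-complete {[]}     _ = tt
  all-complete {x ∷ xs} h = from T-∧ (h (here refl) , all-complete (h ∘ there))

T-not : ∀ {b} → T (not b) → ¬ T b
T-not {false} _ ()

¬⇒T-not : ∀ {b} → ¬ T b → T (not b)
¬⇒T-not {false} _  = tt
¬⇒T-not {true}  ¬t = ¬t tt

∈-nonRoot⁺ : ∀ {n j} → j ∈⟨ 1 , suc n ] → j ∈ nonRoot n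
∈-nonRoot⁺ (s≤s (s≤s z≤n) , s≤s j<n) = ∈-map⁺ (λ k → 2 + k) (∈-upTo⁺ j<n)

∈-nonRoot⁻ : ∀ {n j} → j ∈ nonRoot n → j ∈⟨ 1 , suc n ]
∈-nonRoot⁻ {n} j∈ with k , k∈ , refl ← ∈-map⁻ (λ k → 2 + k) j∈ = s≤s (s≤s z≤n) , s≤s (∈-upTo⁻ {n} k∈)

min≡⊓ : ∀ a b → min a b ≡ a ⊓ b
min≡⊓ a b with a ≤ᵇ b | ≤ᵇ⇒≤ a b | ≤⇒≤ᵇ {a} {b}
... | true  | a≤b | _   = sym (m≤n⇒m⊓n≡m (a≤b tt))
... | false | _   | a≰b = sym (m≥n⇒m⊓n≡n (≰⇒≥ a≰b))

max≡⊔ : ∀ a b → max a b ≡ a ⊔ b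
max≡⊔ a b with a ≤ᵇ b | ≤ᵇ⇒≤ a b | ≤⇒≤ᵇ {a} {b}
... | true  | a≤b | _   = sym (m≤n⇒m⊔n≡n (a≤b tt))
... | false | _   | a≰b = sym (m≥n⇒m⊔n≡m (≰⇒≥ a≰b))

<ᵇ-chain⁺ : ∀ {a b c d e f} → (a < b) × (c < d) × (e < f) → T ((a <ᵇ b) ∧ (c <ᵇ d) ∧ (e <ᵇ f))
<ᵇ-chain⁺ (h , i , j) = from T-∧ (<⇒<ᵇ h , from T-∧ (<⇒<ᵇ i , <⇒<ᵇ j))

<ᵇ-chain⁻ : ∀ {a b c d e f} → T ((a <ᵇ b) ∧ (c <ᵇ d) ∧ (e <ᵇ f)) → (a < b) × (c < d) × (e < f)
<ᵇ-chain⁻ h = let h₁ , h₂₃ = to T-∧ h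
                  h₂ , h₃ = to T-∧ h₂₃
              in <ᵇ⇒< _ _ h₁ , <ᵇ⇒< _ _ h₂ , <ᵇ⇒< _ _ h₃

module _ {n} (v : Vec ℕ n) where

  edgesCross⁺ : ∀ j k → EdgesCross (par v) j k → T (edgesCross v j k)
  edgesCross⁺ j k cr
    rewrite min≡⊓ j (par v j) | max≡⊔ j (par v j) | min≡⊓ k (par v k) | max≡⊔ k (par v k)
    = from T-∨ (inj₁ (<ᵇ-chain⁺ cr))

  edgesCross⁻ : ∀ j k → T (edgesCross v j k) → EdgesCross (par v) j k ⊎ EdgesCross (par v) k j
  edgesCross⁻ j k cr
    rewrite min≡⊓ j (par v j) | max≡⊔ j (par v j) | min≡⊓ k (par v k) | max≡⊔ k (par v k)
    with to T-∨ cr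
  ... | inj₁ h = inj₁ (<ᵇ-chain⁻ h)
  ... | inj₂ h = inj₂ (<ᵇ-chain⁻ h)

  reachesRoot⁺ : ∀ {m j} → Reaches (par v) 1 m j → T (reachesRoot v m j)
  reachesRoot⁺ {zero}  here     = tt
  reachesRoot⁺ {suc m} here     = tt
  reachesRoot⁺         (step h) = from T-∨ (inj₂ (reachesRoot⁺ h))

  reachesRoot⁻ : ∀ m {j} → T (reachesRoot v m j) → Reaches (par v) 1 m j
  reachesRoot⁻ zero    {j} h rewrite ≡ᵇ⇒≡ j 1 h = here
  reachesRoot⁻ (suc m) {j} h with to T-∨ h
  ... | inj₁ j≡1 rewrite ≡ᵇ⇒≡ j 1 j≡1 = here
  ... | inj₂ h′  = step (reachesRoot⁻ m h′)

Represents : ∀ {n} → Vec ℕ n → Tree → Set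
Represents {n} v t = Rootˡ (par v) 1 (suc n) t

decode : ∀ {n} (v : Vec ℕ n) → T (isNCT v) → ∃ (Represents v)
decode {n} v h = Decode.decodeˡ (par v) (suc n)
  (λ {x} {y} x∈ y∈ cr → T-not (all-sound (all-sound (proj₂ (to T-∧ h)) (∈-nonRoot⁺ x∈)) (∈-nonRoot⁺ y∈))
                      (edgesCross⁺ v x y cr))
  (λ x∈ → n , reachesRoot⁻ v n (proj₂ (to T-∧ (proj₂ (vertex x∈)))))
  n (≤-reflexive (+-comm 1 n)) ≤-refl (s≤s z≤n) ≤-refl
  (λ x∈ → let l , u = vertex x∈ in ≤ᵇ⇒≤ _ _ l , ≤ᵇ⇒≤ _ _ (proj₁ (to T-∧ u)))
  where
  vertex : ∀ {x} → x ∈⟨ 1 , suc n ] →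
           T (1 ≤ᵇ par v x) × T ((par v x ≤ᵇ suc n) ∧ reachesRoot v n x)
  vertex x∈ = to T-∧ (all-sound (proj₁ (to T-∧ h)) (∈-nonRoot⁺ x∈))

Represents⇒isNCT : ∀ {n} (v : Vec ℕ n) {t} → Represents v t → T (isNCT v)
Represents⇒isNCT {n} v r = from T-∧
  ( all-complete (λ j∈ →
      let l , u = closedˡ r (∈-nonRoot⁻ j∈)
      in from T-∧ (≤⇒≤ᵇ l , from T-∧ (≤⇒≤ᵇ u ,
           reachesRoot⁺ v (reachesˡ n r (≤-reflexive (+-comm 1 n)) (∈-nonRoot⁻ j∈)))))
  , all-complete (λ {j} j∈ → all-complete (λ {k} k∈ → ¬⇒T-not (λ cr → noCross j∈ k∈ (edgesCross⁻ v j k cr)))))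
  where
  noCross : ∀ {j k} → j ∈ nonRoot n → k ∈ nonRoot n → ¬ (EdgesCross (par v) j k ⊎ EdgesCross (par v) k j)
  noCross {j} {k} j∈ k∈ (inj₁ cr) = noncrossingˡ r (∈-nonRoot⁻ j∈) (∈-nonRoot⁻ k∈) cr
  noCross {j} {k} j∈ k∈ (inj₂ cr) = noncrossingˡ r (∈-nonRoot⁻ k∈) (∈-nonRoot⁻ j∈) cr

parents : ∀ n → (ℕ → ℕ) → Vec ℕ n
parents zero    p = []
parents (suc n) p = p 2 ∷ parents n (p ∘ suc)

par-parents : ∀ n p {j} → j ∈⟨ 1 , suc n ] → par (parents n p) j ≡ p j
par-parents zero    p (1<j , j≤1) = contradiction j≤1 (<⇒≱ 1<j)
par-parents (suc n) p {suc zero}          (s≤s () , _)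
par-parents (suc n) p {suc (suc zero)}    _ = refl
par-parents (suc n) p {suc (suc (suc j))} (_ , s≤s j≤n) =
  par-parents n (p ∘ suc) (s≤s (s≤s z≤n) , j≤n)

par-injective : ∀ {n} {v w : Vec ℕ n} → (∀ {j} → j ∈⟨ 1 , suc n ] → par v j ≡ par w j) → v ≡ w
par-injective {v = []}    {[]}    _ = refl
par-injective {v = x ∷ v} {y ∷ w} h = cong₂ _∷_ (h {2} (s≤s (s≤s z≤n) , s≤s (s≤s z≤n)))
  (par-injective λ { {suc (suc j)} (s≤s (s≤s z≤n) , u) → h {suc (suc (suc j))} (s≤s (s≤s z≤n) , s≤s u) })

-- Outside `2, ..., n + 1` the default value of `par` is 0, so a positive value certifies a vertex.
par-domain : ∀ {n} (v : Vec ℕ n) {j} → 0 < par v j → j ∈⟨ 1 , suc n ]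
par-domain (x ∷ v) {suc (suc zero)}    _ = s≤s (s≤s z≤n) , s≤s (s≤s z≤n)
par-domain (x ∷ v) {suc (suc (suc j))} h = s≤s (s≤s z≤n) , s≤s (proj₂ (par-domain v {suc (suc j)} h))

Represents-unique : ∀ {n} (v : Vec ℕ n) {t t′} → Represents v t → Represents v t′ → t ≡ t′
Represents-unique _ = shape-uniqueˡ

Represents-injective : ∀ {n} {v w : Vec ℕ n} {t} → Represents v t → Represents w t → v ≡ w
Represents-injective r r′ = par-injective (agreeˡ r r′)

Represents-size : ∀ {n} (v : Vec ℕ n) {t} → Represents v t → n ≡ size t
Represents-size v {t} r = suc-injective (trans (sizeˡ r) (+-comm (size t) 1))

encode : ∀ {n} t → n ≡ size t → Σ (Vec ℕ n) λ v → Represents v t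
encode {n} t refl with realiseˡ t 1
... | p , b , r with refl ← trans (sizeˡ r) (+-comm (size t) 1) =
  parents n p , transportˡ (λ x∈ → sym (par-parents n p x∈)) r

-- Parity of descents and the sign-reversing involution on shapes

evenᵇ-suc : ∀ n → evenᵇ (suc n) ≡ not (evenᵇ n)
evenᵇ-suc zero          = refl
evenᵇ-suc (suc zero)    = refl
evenᵇ-suc (suc (suc n)) = evenᵇ-suc n

evenᵇ-+ : ∀ m n → evenᵇ m ≡ true → evenᵇ (m + n) ≡ evenᵇ n
evenᵇ-+ zero          n _ = refl
evenᵇ-+ (suc (suc m)) n h = evenᵇ-+ m n h

-- `degree x` counts the left children of the outermost child. The edges at the root of the shape
-- itself are left out, since they are descents only when the shape is a left part.
desc : Tree → ℕ
desc leaf         = 0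
desc (node s x y) = desc s + degree x + desc x + desc y

allNodes : (ℕ → ℕ → Bool) → Tree → Bool
allNodes q leaf         = true
allNodes q (node s x y) = allNodes q s ∧ allNodes q x ∧ q (degree x) (degree y) ∧ allNodes q y

evenProper oddProper : ℕ → ℕ → Bool
evenProper l r = evenᵇ l ∧ (r ≡ᵇ 0)
oddProper  l r = evenᵇ r ∧ (l ≡ᵇ 0)

proper : Tree → Bool
proper = allNodes evenProper

-- The descents are grouped by parent, and each group is even.
proper⇒even-desc : ∀ t → proper t ≡ true → evenᵇ (desc t) ≡ true
proper⇒even-desc leaf _ = refl
proper⇒even-desc (node s x y) h
  with proper s in ps | proper x in px | evenᵇ (degree x) in ex | degree y ≡ᵇ 0 | proper y in py
proper⇒even-desc (node s x y) refl | true | true | true | true | true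
  rewrite +-assoc (desc s + degree x) (desc x) (desc y) | +-assoc (desc s) (degree x) (desc x + desc y)
        | evenᵇ-+ (desc s) (degree x + (desc x + desc y)) (proper⇒even-desc s ps)
        | evenᵇ-+ (degree x) (desc x + desc y) ex
        | evenᵇ-+ (desc x) (desc y) (proper⇒even-desc x px)
  = proper⇒even-desc y py

oddProper⇒no-desc : ∀ t → allNodes oddProper t ≡ true → desc t ≡ 0
oddProper⇒no-desc leaf _ = refl
oddProper⇒no-desc (node s x y) h
  with allNodes oddProper s in ps | allNodes oddProper x in px | evenᵇ (degree y)
     | degree x in dx | allNodes oddProper y in py
oddProper⇒no-desc (node s x y) refl | true | true | true | zero | true
  rewrite oddProper⇒no-desc s ps | oddProper⇒no-desc x px | oddProper⇒no-desc y py = refl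
oddProper⇒no-desc (node s x y) () | true | true | true | suc _ | true

-- At the first improper vertex, the outermost right child becomes the outermost
-- left child (addLeft), or conversely (dropLeft).
infix 4 _~_
data _~_ : Tree → Tree → Set where
  inSiblings : ∀ {s s′ x y} → s ~ s′ → node s x y ~ node s′ x y
  addLeft    : ∀ {s x s′ x′ y′} → proper s ≡ true → evenᵇ (degree x) ≡ true →
               node s x (node s′ x′ y′) ~ node s (node x x′ y′) s′
  dropLeft   : ∀ {s x s′ x′ y′} → proper s ≡ true → evenᵇ (degree x) ≡ true →
               node s (node x x′ y′) s′ ~ node s x (node s′ x′ y′)
  inLeft     : ∀ {s x x′} → proper s ≡ true → evenᵇ (degree x) ≡ true → x ~ x′ →
               node s x leaf ~ node s x′ leaf

~-improper : ∀ {t t′} → t ~ t′ → proper t ≡ false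
~-improper (inSiblings h) rewrite ~-improper h = refl
~-improper (addLeft {x = x} ps ex) rewrite ps | ex = ∧-zeroʳ (proper x)
~-improper (dropLeft {x = x} {x′ = x′} {y′} ps ex) rewrite ps | evenᵇ-suc (degree x) | ex =
  ∧-zeroʳ (proper (node x x′ y′))
~-improper (inLeft ps _ h) rewrite ps | ~-improper h = refl

-- A move inside a left part must not spoil the vertex above it: this carries the parity premise of
-- `inLeft` over in `~-sym`.
~-degree : ∀ {t t′} → t ~ t′ → degree t ≡ degree t′
~-degree (inSiblings h) = cong suc (~-degree h)
~-degree (addLeft _ _)  = refl
~-degree (dropLeft _ _) = refl
~-degree (inLeft _ _ _) = refl

~-sym : ∀ {t t′} → t ~ t′ → t′ ~ t
~-sym (inSiblings h)   = inSiblings (~-sym h)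
~-sym (addLeft ps ex)  = dropLeft ps ex
~-sym (dropLeft ps ex) = addLeft ps ex
~-sym (inLeft ps ex h) = inLeft ps (subst (λ d → evenᵇ d ≡ true) (~-degree h) ex) (~-sym h)

~-size : ∀ {t t′} → t ~ t′ → size t ≡ size t′
~-size (inSiblings {x = x} {y} h) = cong (λ n → suc (n + size x + size y)) (~-size h)
~-size (addLeft {s} {x} {s′} {x′} {y′} _ _) =
  solve 5 (λ s x s′ x′ y′ → con 1 :+ (s :+ x :+ (con 1 :+ (s′ :+ x′ :+ y′)))
                         := con 1 :+ (s :+ (con 1 :+ (x :+ x′ :+ y′)) :+ s′))
    refl (size s) (size x) (size s′) (size x′) (size y′)
  where open +-*-Solver
~-size (dropLeft {s} {x} {s′} {x′} {y′} ps ex) = sym (~-size (addLeft {s} {x} {s′} {x′} {y′} ps ex))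
~-size (inLeft {s} _ _ h) = cong (λ n → suc (size s + n + 0)) (~-size h)

Adjacent : ℕ → ℕ → Set
Adjacent m n = n ≡ suc m ⊎ m ≡ suc n

Adjacent-+ : ∀ k {m n} → Adjacent m n → Adjacent (k + m) (k + n)
Adjacent-+ k (inj₁ refl) = inj₁ (+-suc k _)
Adjacent-+ k (inj₂ refl) = inj₂ (+-suc k _)

+-Adjacent : ∀ k {m n} → Adjacent m n → Adjacent (m + k) (n + k)
+-Adjacent k (inj₁ refl) = inj₁ refl
+-Adjacent k (inj₂ refl) = inj₂ refl

-- The moved child takes its own left and right parts along, so only its own edge changes sides.
~-desc : ∀ {t t′} → t ~ t′ → Adjacent (desc t) (desc t′)
~-desc (inSiblings {x = x} {y} h) =
  +-Adjacent (desc y) (+-Adjacent (desc x) (+-Adjacent (degree x) (~-desc h)))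
~-desc (addLeft {s} {x} {s′} {x′} {y′} _ _) = inj₁
  (solve 7 (λ s n x s′ n′ x′ y′ → s :+ (con 1 :+ n) :+ (x :+ n′ :+ x′ :+ y′) :+ s′
                               := con 1 :+ (s :+ n :+ x :+ (s′ :+ n′ :+ x′ :+ y′)))
    refl (desc s) (degree x) (desc x) (desc s′) (degree x′) (desc x′) (desc y′))
  where open +-*-Solver
~-desc (dropLeft {s} {x} {s′} {x′} {y′} ps ex) = swap (~-desc (addLeft {s} {x} {s′} {x′} {y′} ps ex))
~-desc (inLeft {s} {x} _ _ h) rewrite sym (~-degree h) =
  +-Adjacent 0 (Adjacent-+ (desc s + degree x) (~-desc h))

~-parity : ∀ {t t′} → t ~ t′ → evenᵇ (desc t′) ≢ evenᵇ (desc t)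
~-parity {t} {t′} h with ~-desc h
... | inj₁ eq rewrite eq | evenᵇ-suc (desc t)  = not-¬ refl ∘ sym
... | inj₂ eq rewrite eq | evenᵇ-suc (desc t′) = not-¬ refl

-- The constructors exclude each other: `proper s` fails once `s` admits a move, the parity of the
-- left degree separates `dropLeft` from `addLeft` and `inLeft`, and the presence of a right child
-- separates these two.
~-functional : ∀ {t t₁ t₂} → t ~ t₁ → t ~ t₂ → t₁ ≡ t₂
~-functional (inSiblings h) (inSiblings h′) = cong (λ s → node s _ _) (~-functional h h′)
~-functional (inSiblings h) (addLeft ps _)  = contradiction (trans (sym ps) (~-improper h)) λ ()
~-functional (inSiblings h) (dropLeft ps _) = contradiction (trans (sym ps) (~-improper h)) λ ()
~-functional (inSiblings h) (inLeft ps _ _) = contradiction (trans (sym ps) (~-improper h)) λ ()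
~-functional (addLeft ps _) (inSiblings h)  = contradiction (trans (sym ps) (~-improper h)) λ ()
~-functional (addLeft _ _)  (addLeft _ _)   = refl
~-functional (addLeft _ ex) (dropLeft {x = x} _ ex′) =
  contradiction (trans (sym ex) (trans (evenᵇ-suc (degree x)) (cong not ex′))) λ ()
~-functional (dropLeft ps _) (inSiblings h)  = contradiction (trans (sym ps) (~-improper h)) λ ()
~-functional (dropLeft {x = x} _ ex) (addLeft _ ex′) =
  contradiction (trans (sym ex′) (trans (evenᵇ-suc (degree x)) (cong not ex))) λ ()
~-functional (dropLeft _ _) (dropLeft _ _)   = refl
~-functional (dropLeft {x = x} _ ex) (inLeft _ ex′ _) =
  contradiction (trans (sym ex′) (trans (evenᵇ-suc (degree x)) (cong not ex))) λ ()
~-functional (inLeft ps _ _) (inSiblings h)  = contradiction (trans (sym ps) (~-improper h)) λ ()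
~-functional (inLeft _ ex _) (dropLeft {x = x} _ ex′) =
  contradiction (trans (sym ex) (trans (evenᵇ-suc (degree x)) (cong not ex′))) λ ()
~-functional (inLeft _ _ h) (inLeft _ _ h′) = cong (λ x → node _ x leaf) (~-functional h h′)

proper⊎~ : ∀ t → proper t ≡ true ⊎ ∃ (t ~_)
proper⊎~ leaf = inj₁ refl
proper⊎~ (node s x y) with proper⊎~ s
... | inj₂ (_ , h) = inj₂ (_ , inSiblings h)
... | inj₁ ps with evenᵇ (degree x) in ex
proper⊎~ (node s x (node s′ x′ y′)) | inj₁ ps | true  = inj₂ (_ , addLeft ps ex)
-- An odd number of left children is positive, so there is one to drop.
proper⊎~ (node s (node x x′ y′) s′) | inj₁ ps | false = inj₂ (_ , dropLeft ps even)
  where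
  even : evenᵇ (degree x) ≡ true
  even = trans (sym (not-involutive _)) (cong not (trans (sym (evenᵇ-suc (degree x))) ex))
proper⊎~ (node s x leaf) | inj₁ ps | true with proper⊎~ x
... | inj₂ (_ , h) = inj₂ (_ , inLeft ps ex h)
... | inj₁ px rewrite ps | px = inj₁ refl

-- Descents and children as counts over intervals of vertices

range′ : ℕ → ℕ → List ℕ
range′ a zero    = []
range′ a (suc m) = a ∷ range′ (suc a) m

range : ℕ → ℕ → List ℕ
range a b = range′ a (b ∸ a)

range′-++ : ∀ a m n → range′ a (m + n) ≡ range′ a m ++ range′ (a + m) n
range′-++ a zero    n rewrite +-identityʳ a = refl
range′-++ a (suc m) n rewrite range′-++ (suc a) m n | +-suc a m = refl

range-++ : ∀ {a b c} → a ≤ b → b ≤ c → range a c ≡ range a b ++ range b c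
range-++ {a} {b} {c} a≤b b≤c
  with m , refl ← m≤n⇒∃[o]m+o≡n a≤b
  with n , refl ← m≤n⇒∃[o]m+o≡n b≤c
  rewrite m+n∸m≡n a m | m+n∸m≡n (a + m) n | +-assoc a m n | m+n∸m≡n a (m + n) = range′-++ a m n

range-∷ : ∀ {a b} → a < b → range a b ≡ a ∷ range (suc a) b
range-∷ {a} a<b with m , refl ← m≤n⇒∃[o]m+o≡n a<b
  rewrite sym (+-suc a m) | m+n∸m≡n a (suc m) | +-suc a m | m+n∸m≡n a m = refl

range-empty : ∀ a → range a a ≡ []
range-empty a rewrite n∸n≡0 a = refl

nonRoot≡range : ∀ n → nonRoot n ≡ range 2 (2 + n)
nonRoot≡range n = trans (map-applyUpTo id (λ k → 2 + k) n) (applyUpTo≡range′ 2 n (λ _ → refl))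
  where
  applyUpTo≡range′ : ∀ {f} a n → (∀ i → f i ≡ a + i) → applyUpTo f n ≡ range′ a n
  applyUpTo≡range′ a zero    h = refl
  applyUpTo≡range′ a (suc n) h = cong₂ _∷_ (trans (h 0) (+-identityʳ a))
    (applyUpTo≡range′ (suc a) n (λ i → trans (h (suc i)) (+-suc a i)))

∈-range⁻ : ∀ {a b x} → x ∈ range a b → x ∈[ a , b ⟩
∈-range⁻ {a} {b} x∈ with ≤-total a b
... | inj₂ b≤a rewrite m≤n⇒m∸n≡0 b≤a = contradiction x∈ λ ()
... | inj₁ a≤b with m , refl ← m≤n⇒∃[o]m+o≡n a≤b rewrite m+n∸m≡n a m = ∈-range′⁻ m x∈
  where
  ∈-range′⁻ : ∀ {a x} m → x ∈ range′ a m → x ∈[ a , a + m ⟩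
  ∈-range′⁻ {a} (suc m) (here refl) = ≤-refl , m<m+n a (s≤s z≤n)
  ∈-range′⁻ {a} {x} (suc m) (there x∈) =
    let l , u = ∈-range′⁻ m x∈ in <⇒≤ l , subst (x <_) (sym (+-suc a m)) u

range-splitˡ : ∀ {a k c b} → a ≤ k → k < c → c ≤ b → range (suc a) (suc b) ≡
               range (suc a) (suc k) ++ range (suc k) c ++ c ∷ range (suc c) (suc b)
range-splitˡ {a} {k} {c} a≤k k<c c≤b
  rewrite range-++ (s≤s a≤k) (≤-trans k<c (≤-trans c≤b (n≤1+n _)))
        | range-++ k<c (≤-trans c≤b (n≤1+n _)) | range-∷ (s≤s c≤b) = refl

range-splitʳ : ∀ {a c k b} → a ≤ c → c ≤ k → k < b → range a b ≡
               range a c ++ c ∷ range (suc c) (suc k) ++ range (suc k) b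
range-splitʳ {a} {c} {k} a≤c c≤k k<b
  rewrite range-++ a≤c (<⇒≤ (≤-<-trans c≤k k<b)) | range-∷ (≤-<-trans c≤k k<b)
        | range-++ (s≤s c≤k) k<b = refl

all-++ : ∀ {A : Set} (f : A → Bool) xs ys → all f (xs ++ ys) ≡ all f xs ∧ all f ys
all-++ f []       ys = refl
all-++ f (x ∷ xs) ys = trans (cong (f x ∧_) (all-++ f xs ys)) (sym (∧-assoc (f x) _ _))

all-splitˡ : ∀ f {a k c b} → a ≤ k → k < c → c ≤ b → all f (range (suc a) (suc b)) ≡
             all f (range (suc a) (suc k)) ∧ all f (range (suc k) c) ∧ f c ∧ all f (range (suc c) (suc b))
all-splitˡ f {a} {k} {c} {b} a≤k k<c c≤b
  rewrite range-splitˡ a≤k k<c c≤b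
        | all-++ f (range (suc a) (suc k)) (range (suc k) c ++ c ∷ range (suc c) (suc b))
        | all-++ f (range (suc k) c) (c ∷ range (suc c) (suc b)) = refl

all-splitʳ : ∀ f {a c k b} → a ≤ c → c ≤ k → k < b → all f (range a b) ≡
             all f (range a c) ∧ f c ∧ all f (range (suc c) (suc k)) ∧ all f (range (suc k) b)
all-splitʳ f {a} {c} {k} {b} a≤c c≤k k<b
  rewrite range-splitʳ a≤c c≤k k<b
        | all-++ f (range a c) (c ∷ range (suc c) (suc k) ++ range (suc k) b)
        | all-++ f (range (suc c) (suc k)) (range (suc k) b) = refl

count : (ℕ → Bool) → List ℕ → ℕ
count f xs = length (filterᵇ f xs)

count-++ : ∀ f xs ys → count f (xs ++ ys) ≡ count f xs + count f ys
count-++ f xs ys = trans (cong length (filter-++ (T? ∘ f) xs ys)) (length-++ (filterᵇ f xs))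

count-splitˡ : ∀ f {a k c b} → a ≤ k → k < c → c ≤ b → count f (range (suc a) (suc b)) ≡
               count f (range (suc a) (suc k)) +
               (count f (range (suc k) c) + (count f (c ∷ []) + count f (range (suc c) (suc b))))
count-splitˡ f {a} {k} {c} {b} a≤k k<c c≤b
  rewrite range-splitˡ a≤k k<c c≤b
        | count-++ f (range (suc a) (suc k)) (range (suc k) c ++ c ∷ range (suc c) (suc b))
        | count-++ f (range (suc k) c) (c ∷ range (suc c) (suc b))
        | count-++ f (c ∷ []) (range (suc c) (suc b)) = refl

count-splitʳ : ∀ f {a c k b} → a ≤ c → c ≤ k → k < b → count f (range a b) ≡
               count f (range a c) +
               (count f (c ∷ []) + (count f (range (suc c) (suc k)) + count f (range (suc k) b)))
count-splitʳ f {a} {c} {k} {b} a≤c c≤k k<b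
  rewrite range-splitʳ a≤c c≤k k<b
        | count-++ f (range a c) (c ∷ range (suc c) (suc k) ++ range (suc k) b)
        | count-++ f (c ∷ []) (range (suc c) (suc k) ++ range (suc k) b)
        | count-++ f (range (suc c) (suc k)) (range (suc k) b) = refl

count-true : ∀ f {x} → f x ≡ true → count f (x ∷ []) ≡ 1
count-true f fx rewrite fx = refl

count-none : ∀ f {xs} → (∀ {x} → x ∈ xs → f x ≡ false) → count f xs ≡ 0
count-none f {[]}     h = refl
count-none f {x ∷ xs} h rewrite h (here refl) = count-none f (h ∘ there)

count-false : ∀ f {x} → f x ≡ false → count f (x ∷ []) ≡ 0
count-false f fx rewrite fx = refl

¬T⇒false : ∀ {b} → ¬ T b → b ≡ false
¬T⇒false {false} _  = refl
¬T⇒false {true}  ¬t = contradiction tt ¬t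

≢⇒≡ᵇ-false : ∀ {m n} → m ≢ n → (m ≡ᵇ n) ≡ false
≢⇒≡ᵇ-false m≢n = ¬T⇒false (m≢n ∘ ≡ᵇ⇒≡ _ _)

≡⇒≡ᵇ-true : ∀ {m n} → m ≡ n → (m ≡ᵇ n) ≡ true
≡⇒≡ᵇ-true m≡n = to T-≡ (≡⇒≡ᵇ _ _ m≡n)

≮⇒<ᵇ-false : ∀ {m n} → n ≤ m → (m <ᵇ n) ≡ false
≮⇒<ᵇ-false n≤m = ¬T⇒false (≤⇒≯ n≤m ∘ <ᵇ⇒< _ _)

<⇒<ᵇ-true : ∀ {m n} → m < n → (m <ᵇ n) ≡ true
<⇒<ᵇ-true m<n = to T-≡ (<⇒<ᵇ m<n)

∈-range⁻′ : ∀ {a b x} → x ∈ range (suc a) (suc b) → x ∈⟨ a , b ]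
∈-range⁻′ x∈ = let l , u = ∈-range⁻ x∈ in l , ≤-pred u

module _ {p : ℕ → ℕ} where

  private
    isDescent : ℕ → Bool
    isDescent j = j <ᵇ p j

  -- Children of a right end are descents themselves, hence the additional `degree t` in the mirror
  -- statement.
  count-descˡ : ∀ {a b t} → Rootˡ p a b t → count isDescent (range (suc a) (suc b)) ≡ desc t
  count-descʳ : ∀ {a b t} → Rootʳ p a b t → count isDescent (range a b) ≡ degree t + desc t
  count-descˡ {a} leafˡ rewrite range-empty (suc a) = refl
  count-descˡ (nodeˡ {c = c} {s = s} {x} {y} S X pc Y) = trans
    (count-splitˡ isDescent (≤ˡ S) (≤ʳ X) (≤ˡ Y))
    (trans (cong₂ _+_ (count-descˡ S) (cong₂ _+_ (count-descʳ X) (cong₂ _+_ c-ascends (count-descˡ Y))))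
      (solve 4 (λ s d x y → s :+ (d :+ x :+ y) := s :+ d :+ x :+ y)
        refl (desc s) (degree x) (desc x) (desc y)))
    where
    open +-*-Solver
    c-ascends : count isDescent (c ∷ []) ≡ 0
    c-ascends = count-false isDescent
      (≮⇒<ᵇ-false (subst (_≤ c) (sym pc) (≤-trans (≤ˡ S) (<⇒≤ (≤ʳ X)))))
  count-descʳ {a} leafʳ rewrite range-empty a = refl
  count-descʳ (nodeʳ {c = c} {s = s} {x} {y} X pc Y S) = trans
    (count-splitʳ isDescent (≤ʳ X) (≤ˡ Y) (≤ʳ S))
    (trans (cong₂ _+_ (count-descʳ X) (cong₂ _+_ c-descends (cong₂ _+_ (count-descˡ Y) (count-descʳ S))))
      (solve 5 (λ n s d x y → d :+ x :+ (con 1 :+ (y :+ (n :+ s))) := con 1 :+ n :+ (s :+ d :+ x :+ y))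
        refl (degree s) (desc s) (degree x) (desc x) (desc y)))
    where
    open +-*-Solver
    c-descends : count isDescent (c ∷ []) ≡ 1
    c-descends = count-true isDescent
      (<⇒<ᵇ-true (subst (c <_) (sym pc) (≤-<-trans (≤ˡ Y) (≤ʳ S))))

  -- `f` stays abstract to absorb the side test in `rightCount`, which holds automatically on the
  -- interval. Parents of vertices around `c` lie strictly beyond `a`, so only the siblings and `c`
  -- contribute.
  count-childrenˡ : ∀ {a b t} f → Rootˡ p a b t → (∀ {x} → x ∈⟨ a , b ] → f x ≡ (p x ≡ᵇ a)) →
                    count f (range (suc a) (suc b)) ≡ degree t
  count-childrenˡ {a} f leafˡ _ rewrite range-empty (suc a) = refl
  count-childrenˡ {a} f (nodeˡ {c = c} {s = s} S X pc Y) h = trans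
    (count-splitˡ f (≤ˡ S) (≤ʳ X) (≤ˡ Y))
    (trans (cong₂ _+_ siblings (cong₂ _+_ left (cong₂ _+_ child right))) (+-comm (degree s) 1))
    where
    a<c      = ≤-<-trans (≤ˡ S) (≤ʳ X)
    siblings = count-childrenˡ f S (λ (l , u) → h (l , ≤-trans u (≤-trans (<⇒≤ (≤ʳ X)) (≤ˡ Y))))
    left     = count-none f (λ x∈ → let l , u = ∈-range⁻ x∈ in trans
      (h (≤-<-trans (≤ˡ S) l , ≤-trans (<⇒≤ u) (≤ˡ Y)))
      (≢⇒≡ᵇ-false (>⇒≢ (≤-<-trans (≤ˡ S) (proj₁ (closedʳ X (l , u)))))))
    child    = count-true f {c} (trans (h (a<c , ≤ˡ Y)) (≡⇒≡ᵇ-true pc))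
    right    = count-none f (λ x∈ → let l , u = ∈-range⁻′ x∈ in trans
      (h (<-trans a<c l , u))
      (≢⇒≡ᵇ-false (>⇒≢ (<-≤-trans a<c (proj₁ (closedˡ Y (l , u)))))))

  count-childrenʳ : ∀ {a b t} f → Rootʳ p a b t → (∀ {x} → x ∈[ a , b ⟩ → f x ≡ (p x ≡ᵇ b)) →
                    count f (range a b) ≡ degree t
  count-childrenʳ {a} f leafʳ _ rewrite range-empty a = refl
  count-childrenʳ f (nodeʳ {c = c} X pc Y S) h = trans
    (count-splitʳ f (≤ʳ X) (≤ˡ Y) (≤ʳ S))
    (cong₂ _+_ left (cong₂ _+_ child (cong₂ _+_ right siblings)))
    where
    c<b      = ≤-<-trans (≤ˡ Y) (≤ʳ S)
    left     = count-none f (λ x∈ → let l , u = ∈-range⁻ x∈ in trans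
      (h (l , <-trans u c<b))
      (≢⇒≡ᵇ-false (<⇒≢ (≤-<-trans (proj₂ (closedʳ X (l , u))) c<b))))
    child    = count-true f {c} (trans (h (≤ʳ X , c<b)) (≡⇒≡ᵇ-true pc))
    right    = count-none f (λ x∈ → let l , u = ∈-range⁻′ x∈ in trans
      (h (≤-trans (≤ʳ X) (<⇒≤ l) , ≤-<-trans u (≤ʳ S)))
      (≢⇒≡ᵇ-false (<⇒≢ (≤-<-trans (proj₂ (closedˡ Y (l , u))) (≤ʳ S)))))
    siblings = count-childrenʳ f S (λ (l , u) → h (≤-trans (≤ʳ X) (≤-trans (≤ˡ Y) (<⇒≤ l)) , u))

module _ (p : ℕ → ℕ) (n : ℕ) where

  leftCount rightCount : ℕ → ℕ
  leftCount  u = count (λ j → (p j ≡ᵇ u) ∧ (j <ᵇ u)) (range 2 (2 + n))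
  rightCount u = count (λ j → (p j ≡ᵇ u) ∧ (u <ᵇ j)) (range 2 (2 + n))

  -- Vertices before `l` are ruled out by `lower`, those from `c` on by the side test.
  leftCount≡degree : ∀ {l c x} → Rootʳ p l c x → 1 < l → c ≤ suc n →
                     (∀ {j} → p j ≡ c → l ≤ j) → leftCount c ≡ degree x
  leftCount≡degree {l} {c} {x} X 1<l c≤n lower = begin
    count f (range 2 (2 + n))
      ≡⟨ cong (count f) (range-++ 1<l (≤-trans (≤ʳ X) c≤2+n)) ⟩
    count f (range 2 l ++ range l (2 + n))
      ≡⟨ count-++ f (range 2 l) (range l (2 + n)) ⟩
    count f (range 2 l) + count f (range l (2 + n))
      ≡⟨ cong₂ _+_ early (trans (cong (count f) (range-++ (≤ʳ X) c≤2+n))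
           (count-++ f (range l c) (range c (2 + n)))) ⟩
    count f (range l c) + count f (range c (2 + n))
      ≡⟨ cong₂ _+_ children late ⟩
    degree x + 0
      ≡⟨ +-identityʳ (degree x) ⟩
    degree x ∎
    where
    open ≡-Reasoning
    f : ℕ → Bool
    f j = (p j ≡ᵇ c) ∧ (j <ᵇ c)
    c≤2+n    = ≤-trans c≤n (n≤1+n (suc n))
    early    = count-none f {range 2 l} (λ {j} j∈ →
      cong (_∧ (j <ᵇ c)) (≢⇒≡ᵇ-false (λ pj → <⇒≱ (proj₂ (∈-range⁻ j∈)) (lower pj))))
    children = count-childrenʳ f X (λ {j} (_ , u) →
      trans (cong ((p j ≡ᵇ c) ∧_) (<⇒<ᵇ-true u)) (∧-identityʳ _))
    late     = count-none f {range c (2 + n)} (λ {j} j∈ →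
      trans (cong ((p j ≡ᵇ c) ∧_) (≮⇒<ᵇ-false (proj₁ (∈-range⁻ j∈)))) (∧-zeroʳ _))

  rightCount≡degree : ∀ {c b y} → Rootˡ p c b y → 1 ≤ c → b ≤ suc n →
                      (∀ {j} → p j ≡ c → j ≤ b) → rightCount c ≡ degree y
  rightCount≡degree {c} {b} {y} Y 1≤c b≤n upper = begin
    count f (range 2 (2 + n))
      ≡⟨ cong (count f) (range-++ (s≤s 1≤c) (s≤s (≤-trans (≤ˡ Y) b≤n))) ⟩
    count f (range 2 (suc c) ++ range (suc c) (2 + n))
      ≡⟨ count-++ f (range 2 (suc c)) (range (suc c) (2 + n)) ⟩
    count f (range 2 (suc c)) + count f (range (suc c) (2 + n))
      ≡⟨ cong₂ _+_ early (trans (cong (count f) (range-++ (s≤s (≤ˡ Y)) (s≤s b≤n)))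
           (count-++ f (range (suc c) (suc b)) (range (suc b) (2 + n)))) ⟩
    count f (range (suc c) (suc b)) + count f (range (suc b) (2 + n))
      ≡⟨ cong₂ _+_ children late ⟩
    degree y + 0
      ≡⟨ +-identityʳ (degree y) ⟩
    degree y ∎
    where
    open ≡-Reasoning
    f : ℕ → Bool
    f j = (p j ≡ᵇ c) ∧ (c <ᵇ j)
    early    = count-none f {range 2 (suc c)} (λ {j} j∈ →
      trans (cong ((p j ≡ᵇ c) ∧_) (≮⇒<ᵇ-false (≤-pred (proj₂ (∈-range⁻ j∈))))) (∧-zeroʳ _))
    children = count-childrenˡ f Y (λ {j} (l , _) →
      trans (cong ((p j ≡ᵇ c) ∧_) (<⇒<ᵇ-true l)) (∧-identityʳ _))
    late     = count-none f {range (suc b) (2 + n)} (λ {j} j∈ →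
      cong (_∧ (c <ᵇ j)) (≢⇒≡ᵇ-false (λ pj → <⇒≱ (proj₁ (∈-range⁻ {suc b} {2 + n} j∈)) (upper pj))))

  module _ (q : ℕ → ℕ → Bool) where

    private
      vertexCheck : ℕ → Bool
      vertexCheck u = q (leftCount u) (rightCount u)

    -- The child counts range over all vertices, so the induction must also carry the converse of
    -- closure: a vertex outside the interval has no parent among its non-root vertices.
    all-verticesˡ : ∀ {a b t} → Rootˡ p a b t → 1 ≤ a → b ≤ suc n →
                    (∀ {j} → p j ∈⟨ a , b ] → j ∈⟨ a , b ]) →
                    all vertexCheck (range (suc a) (suc b)) ≡ allNodes q t
    all-verticesʳ : ∀ {a b t} → Rootʳ p a b t → 1 < a → b ≤ suc n →
                    (∀ {j} → p j ∈[ a , b ⟩ → j ∈[ a , b ⟩) →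
                    all vertexCheck (range a b) ≡ allNodes q t
    all-verticesˡ {a} leafˡ _ _ _ rewrite range-empty (suc a) = refl
    all-verticesˡ {a} {b} (nodeˡ {k = k} {c} S X pc Y) 1≤a b≤n only = trans
      (all-splitˡ vertexCheck (≤ˡ S) (≤ʳ X) (≤ˡ Y))
      (cong₂ _∧_ (all-verticesˡ S 1≤a (≤-trans k≤b b≤n) onlyS)
      (cong₂ _∧_ (all-verticesʳ X 1<1+k (≤-trans (≤ˡ Y) b≤n) onlyX)
      (cong₂ _∧_ (cong₂ q (leftCount≡degree X 1<1+k (≤-trans (≤ˡ Y) b≤n) (proj₁ ∘ child))
                          (rightCount≡degree Y (≤-trans 1≤a (<⇒≤ a<c)) b≤n (proj₂ ∘ child)))
                 (all-verticesˡ Y (≤-trans 1≤a (<⇒≤ a<c)) b≤n onlyY))))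
      where
      a<c : a < c
      a<c = ≤-<-trans (≤ˡ S) (≤ʳ X)
      k≤b : k ≤ b
      k≤b = ≤-trans (<⇒≤ (≤ʳ X)) (≤ˡ Y)
      1<1+k : 1 < suc k
      1<1+k = s≤s (≤-trans 1≤a (≤ˡ S))
      onlyS : ∀ {j} → p j ∈⟨ a , k ] → j ∈⟨ a , k ]
      onlyS {j} (l , u) with only (l , ≤-trans u k≤b)
      ... | a<j , j≤b with positionˡ k c j
      ...   | inSiblings j≤k = a<j , j≤k
      ...   | inLeft j∈X     = contradiction u (<⇒≱ (proj₁ (closedʳ X j∈X)))
      ...   | atChild refl   = contradiction pc (>⇒≢ l)
      ...   | inRight c<j    = contradiction u (<⇒≱ (<-≤-trans (≤ʳ X) (proj₁ (closedˡ Y (c<j , j≤b)))))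
      onlyX : ∀ {j} → p j ∈[ suc k , c ⟩ → j ∈[ suc k , c ⟩
      onlyX {j} (l , u) with only (≤-<-trans (≤ˡ S) l , ≤-trans (<⇒≤ u) (≤ˡ Y))
      ... | a<j , j≤b with positionˡ k c j
      ...   | inSiblings j≤k = contradiction (proj₂ (closedˡ S (a<j , j≤k))) (<⇒≱ l)
      ...   | inLeft j∈X     = j∈X
      ...   | atChild refl   = contradiction pc (>⇒≢ (≤-<-trans (≤ˡ S) l))
      ...   | inRight c<j    = contradiction (proj₁ (closedˡ Y (c<j , j≤b))) (<⇒≱ u)
      onlyY : ∀ {j} → p j ∈⟨ c , b ] → j ∈⟨ c , b ]
      onlyY {j} (l , u) with only (<-trans a<c l , u)
      ... | a<j , j≤b with positionˡ k c j
      ...   | inSiblings j≤k = contradiction (≤-trans (proj₂ (closedˡ S (a<j , j≤k))) (<⇒≤ (≤ʳ X))) (<⇒≱ l)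
      ...   | inLeft j∈X     = contradiction (proj₂ (closedʳ X j∈X)) (<⇒≱ l)
      ...   | atChild refl   = contradiction pc (>⇒≢ (<-trans a<c l))
      ...   | inRight c<j    = c<j , j≤b
      child : ∀ {j} → p j ≡ c → j ∈[ suc k , b ]
      child {j} pj with only (subst (_∈⟨ a , b ]) (sym pj) (a<c , ≤ˡ Y))
      ... | a<j , j≤b with positionˡ k c j
      ...   | inSiblings j≤k = contradiction (subst (_≤ k) pj (proj₂ (closedˡ S (a<j , j≤k)))) (<⇒≱ (≤ʳ X))
      ...   | inLeft (l , _) = l , j≤b
      ...   | atChild refl   = ≤ʳ X , j≤b
      ...   | inRight c<j    = ≤-trans (≤ʳ X) (<⇒≤ c<j) , j≤b
    all-verticesʳ {a} leafʳ _ _ _ rewrite range-empty a = refl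
    all-verticesʳ {a} {b} (nodeʳ {c = c} {k} {s = s} {x} {y} X pc Y S) 1<a b≤n only = trans
      (all-splitʳ vertexCheck (≤ʳ X) (≤ˡ Y) (≤ʳ S))
      (trans (cong₂ _∧_ (all-verticesʳ X 1<a (≤-trans (<⇒≤ c<b) b≤n) onlyX)
             (cong₂ _∧_ (cong₂ q (leftCount≡degree X 1<a (≤-trans (<⇒≤ c<b) b≤n) (proj₁ ∘ child))
                                 (rightCount≡degree Y 1≤c (≤-trans (<⇒≤ (≤ʳ S)) b≤n) (proj₂ ∘ child)))
             (cong₂ _∧_ (all-verticesˡ Y 1≤c (≤-trans (<⇒≤ (≤ʳ S)) b≤n) onlyY)
                        (all-verticesʳ S (s≤s (≤-trans 1≤c (≤ˡ Y))) b≤n onlyS))))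
             -- With the root at the right end the siblings come last in the interval, whereas
             -- `allNodes` tests them first.
             (siblingsFirst (allNodes q x) _ (allNodes q y) (allNodes q s)))
      where
      c<b : c < b
      c<b = ≤-<-trans (≤ˡ Y) (≤ʳ S)
      siblingsFirst : ∀ α β γ δ → α ∧ β ∧ γ ∧ δ ≡ δ ∧ α ∧ β ∧ γ
      siblingsFirst α β γ δ rewrite ∧-comm δ (α ∧ β ∧ γ) | ∧-assoc α (β ∧ γ) δ | ∧-assoc β γ δ = refl
      1≤c : 1 ≤ c
      1≤c = ≤-trans (<⇒≤ 1<a) (≤ʳ X)
      onlyX : ∀ {j} → p j ∈[ a , c ⟩ → j ∈[ a , c ⟩
      onlyX {j} (l , u) with only (l , <-trans u c<b)
      ... | a≤j , j<b with positionʳ c k j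
      ...   | inLeft j<c     = a≤j , j<c
      ...   | atChild refl   = contradiction pc (<⇒≢ (<-trans u c<b))
      ...   | inRight j∈Y    = contradiction (proj₁ (closedˡ Y j∈Y)) (<⇒≱ u)
      ...   | inSiblings k<j =
        contradiction (≤-trans (≤-trans (≤ˡ Y) (n≤1+n k)) (proj₁ (closedʳ S (k<j , j<b)))) (<⇒≱ u)
      onlyY : ∀ {j} → p j ∈⟨ c , k ] → j ∈⟨ c , k ]
      onlyY {j} (l , u) with only (≤-trans (≤ʳ X) (<⇒≤ l) , ≤-<-trans u (≤ʳ S))
      ... | a≤j , j<b with positionʳ c k j
      ...   | inLeft j<c     = contradiction (proj₂ (closedʳ X (a≤j , j<c))) (<⇒≱ l)
      ...   | atChild refl   = contradiction pc (<⇒≢ (≤-<-trans u (≤ʳ S)))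
      ...   | inRight j∈Y    = j∈Y
      ...   | inSiblings k<j = contradiction u (<⇒≱ (proj₁ (closedʳ S (k<j , j<b))))
      onlyS : ∀ {j} → p j ∈[ suc k , b ⟩ → j ∈[ suc k , b ⟩
      onlyS {j} (l , u) with only (≤-trans (≤ʳ X) (≤-trans (≤ˡ Y) (<⇒≤ l)) , u)
      ... | a≤j , j<b with positionʳ c k j
      ...   | inLeft j<c     = contradiction (≤-trans (proj₂ (closedʳ X (a≤j , j<c))) (≤ˡ Y)) (<⇒≱ l)
      ...   | atChild refl   = contradiction pc (<⇒≢ u)
      ...   | inRight j∈Y    = contradiction (proj₂ (closedˡ Y j∈Y)) (<⇒≱ l)
      ...   | inSiblings k<j = k<j , j<b
      child : ∀ {j} → p j ≡ c → j ∈[ a , k ]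
      child {j} pj with only (subst (_∈[ a , b ⟩) (sym pj) (≤ʳ X , c<b))
      ... | a≤j , j<b with positionʳ c k j
      ...   | inLeft j<c     = a≤j , ≤-trans (<⇒≤ j<c) (≤ˡ Y)
      ...   | atChild refl   = a≤j , ≤ˡ Y
      ...   | inRight (_ , u) = a≤j , u
      ...   | inSiblings k<j =
        contradiction (subst (suc k ≤_) pj (proj₁ (closedʳ S (k<j , j<b)))) (≤⇒≯ (≤ˡ Y))

all-cong : ∀ {A : Set} {f g : A → Bool} → (∀ x → f x ≡ g x) → ∀ xs → all f xs ≡ all g xs
all-cong f≗g []       = refl
all-cong f≗g (x ∷ xs) = cong₂ _∧_ (f≗g x) (all-cong f≗g xs)

isProperVertex-even : ∀ {n} (v : Vec ℕ n) u → isEvenTree v ≡ true →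
                      isProperVertex v u ≡ evenProper (leftChildren v u) (rightChildren v u)
isProperVertex-even v u even rewrite even = refl

isProperVertex-odd : ∀ {n} (v : Vec ℕ n) u → isEvenTree v ≡ false →
                     isProperVertex v u ≡ oddProper (leftChildren v u) (rightChildren v u)
isProperVertex-odd v u odd rewrite odd = refl

module _ {n} (v : Vec ℕ n) {t : Tree} (r : Represents v t) where

  Represents⇒isEvenTree : isEvenTree v ≡ evenᵇ (desc t)
  Represents⇒isEvenTree = cong evenᵇ
    (trans (cong (count (λ j → j <ᵇ par v j)) (nonRoot≡range n)) (count-descˡ r))

  all-children : ∀ q → all (λ u → q (leftChildren v u) (rightChildren v u)) (nonRoot n) ≡ allNodes q t
  all-children q = begin
    all (λ u → q (leftChildren v u) (rightChildren v u)) (nonRoot n)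
      ≡⟨ all-cong (λ u → cong₂ q (cong (count (λ j → (par v j ≡ᵇ u) ∧ (j <ᵇ u))) (nonRoot≡range n))
                                 (cong (count (λ j → (par v j ≡ᵇ u) ∧ (u <ᵇ j))) (nonRoot≡range n)))
           (nonRoot n) ⟩
    all (λ u → q (leftCount (par v) n u) (rightCount (par v) n u)) (nonRoot n)
      ≡⟨ cong (all _) (nonRoot≡range n) ⟩
    all (λ u → q (leftCount (par v) n u) (rightCount (par v) n u)) (range 2 (2 + n))
      ≡⟨ all-verticesˡ (par v) n q r ≤-refl ≤-refl (λ (l , _) → par-domain v (<⇒≤ l)) ⟩
    allNodes q t ∎
    where open ≡-Reasoning

  odd⇒improper : evenᵇ (desc t) ≡ false → proper t ≡ false
  odd⇒improper odd = ¬T⇒false λ h →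
    contradiction (trans (sym odd) (proper⇒even-desc t (to T-≡ h))) λ ()

  -- For an odd tree both sides are false, by `oddProper⇒no-desc` and `proper⇒even-desc`; this is
  -- why one parity-free notion on shapes suffices.
  Represents⇒isProper : isProper v ≡ proper t
  Represents⇒isProper = byParity (isEvenTree v) refl
    where
    open ≡-Reasoning
    byParity : ∀ b → isEvenTree v ≡ b → isProper v ≡ proper t
    byParity true even = begin
      isProper v         ≡⟨ all-cong (λ u → isProperVertex-even v u even) (nonRoot n) ⟩
      all _ (nonRoot n)  ≡⟨ all-children evenProper ⟩
      proper t           ∎
    byParity false odd = begin
      isProper v           ≡⟨ all-cong (λ u → isProperVertex-odd v u odd) (nonRoot n) ⟩
      all _ (nonRoot n)    ≡⟨ all-children oddProper ⟩
      allNodes oddProper t ≡⟨ ¬T⇒false (λ h → contradiction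
                                (trans (sym odd′) (cong evenᵇ (oddProper⇒no-desc t (to T-≡ h)))) λ ()) ⟩
      false                ≡⟨ odd⇒improper odd′ ⟨
      proper t             ∎
      where
      odd′ : evenᵇ (desc t) ≡ false
      odd′ = trans (sym Represents⇒isEvenTree) odd

-- Enumeration of the candidates and transport of the involution

allVecs≡product : ∀ k xs → allVecs (suc k) xs ≡ cartesianProductWith _∷_ xs (allVecs k xs)
allVecs≡product k xs = go xs (allVecs k xs)
  where
  go : ∀ xs ws → concatMap (λ x → map (λ w → x ∷ w) ws) xs ≡ cartesianProductWith _∷_ xs ws
  go []       ws = refl
  go (x ∷ xs) ws = cong (map (x ∷_) ws ++_) (go xs ws)

allVecs-unique : ∀ k {xs} → Unique xs → Unique (allVecs k xs)
allVecs-unique zero    _ = [] ∷ []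
allVecs-unique (suc k) {xs} u rewrite allVecs≡product k xs =
  Unique.cartesianProductWith⁺ _∷_ ∷-injective u (allVecs-unique k u)

∈-allVecs : ∀ {k} {v : Vec ℕ k} {xs} → (∀ {j} → j ∈⟨ 1 , suc k ] → par v j ∈ xs) → v ∈ allVecs k xs
∈-allVecs {v = []}    _ = here refl
∈-allVecs {suc k} {x ∷ v} {xs} h rewrite allVecs≡product k xs = ∈-cartesianProductWith⁺ _∷_
  (h {2} (s≤s (s≤s z≤n) , s≤s (s≤s z≤n)))
  (∈-allVecs λ { {suc (suc j)} (s≤s (s≤s z≤n) , u) → h {suc (suc (suc j))} (s≤s (s≤s z≤n) , s≤s u) })

candidates-unique : ∀ n → Unique (candidates n)
candidates-unique n = allVecs-unique n (Unique.map⁺ suc-injective (Unique.upTo⁺ (suc n)))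

∈-candidates : ∀ {n} (v : Vec ℕ n) {t} → Represents v t → v ∈ candidates n
∈-candidates {n} v r = ∈-allVecs (λ j∈ → label (closedˡ r j∈))
  where
  label : ∀ {x} → x ∈[ 1 , suc n ] → x ∈ map suc (upTo (suc n))
  label (s≤s z≤n , u) = ∈-map⁺ suc (∈-upTo⁺ u)

isImproperNCT : ∀ {n} → Vec ℕ n → Bool
isImproperNCT v = isNCT v ∧ not (isProper v)

-- Being a relation, it is independent of how a partner is computed; functionality and symmetry then
-- give the involution.
infix 4 _⇄_
data _⇄_ {n} (v w : Vec ℕ n) : Set where
  partners : ∀ {t t′} → Represents v t → Represents w t′ → t ~ t′ → v ⇄ w

⇄-sym : ∀ {n} {v w : Vec ℕ n} → v ⇄ w → w ⇄ v
⇄-sym (partners r r′ h) = partners r′ r (~-sym h)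

⇄-functional : ∀ {n} {v w w′ : Vec ℕ n} → v ⇄ w → v ⇄ w′ → w ≡ w′
⇄-functional {v = v} {w} {w′} (partners r₁ s₁ h₁) (partners r₂ s₂ h₂)
  with refl ← Represents-unique v r₁ r₂ with refl ← ~-functional h₁ h₂
  = Represents-injective {v = w} {w′} s₁ s₂

⇄-improper : ∀ {n} {v w : Vec ℕ n} → v ⇄ w → T (isImproperNCT v)
⇄-improper {v = v} (partners r _ h) = from T-∧
  (Represents⇒isNCT v r , from T-not-≡ (trans (Represents⇒isProper v r) (~-improper h)))

⇄-parity : ∀ {n} {v w : Vec ℕ n} → v ⇄ w → isEvenTree w ≢ isEvenTree v
⇄-parity {v = v} {w} (partners r r′ h)
  rewrite Represents⇒isEvenTree v r | Represents⇒isEvenTree w r′ = ~-parity h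

improper⇒⇄ : ∀ {n} (v : Vec ℕ n) → T (isImproperNCT v) → ∃ (v ⇄_)
improper⇒⇄ v h with decode v (proj₁ (to T-∧ h))
... | t , r with proper⊎~ t
...   | inj₁ pt = contradiction
        (trans (sym (to T-not-≡ (proj₂ (to T-∧ h)))) (trans (Represents⇒isProper v r) pt)) λ ()
...   | inj₂ (t′ , t~t′) =
        let w , r′ = encode t′ (trans (Represents-size v r) (~-size t~t′)) in w , partners r r′ t~t′

-- The identity off the improper trees makes this an involution on all vectors, the form in which
-- the counting lemma takes it.
flip : ∀ {n} → Vec ℕ n → Vec ℕ n
flip v with T? (isImproperNCT v)
... | yes h = proj₁ (improper⇒⇄ v h)
... | no  _ = v

flip-⇄ : ∀ {n} (v : Vec ℕ n) → T (isImproperNCT v) → v ⇄ flip v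
flip-⇄ v h with T? (isImproperNCT v)
... | yes h′ = proj₂ (improper⇒⇄ v h′)
... | no  ¬h = contradiction h ¬h

flip-fixed : ∀ {n} (v : Vec ℕ n) → ¬ T (isImproperNCT v) → flip v ≡ v
flip-fixed v ¬h with T? (isImproperNCT v)
... | yes h = contradiction h ¬h
... | no  _ = refl

flip-improper : ∀ {n} (v : Vec ℕ n) → T (isImproperNCT v) → T (isImproperNCT (flip v))
flip-improper v h = ⇄-improper (⇄-sym (flip-⇄ v h))

flip-parity : ∀ {n} (v : Vec ℕ n) → T (isImproperNCT v) → isEvenTree (flip v) ≢ isEvenTree v
flip-parity v h = ⇄-parity (flip-⇄ v h)

-- For improper `v`, both `v` and `flip (flip v)` are partners of `flip v`.
flip-involutive : ∀ {n} (v : Vec ℕ n) → flip (flip v) ≡ v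
flip-involutive v = byCase (T? (isImproperNCT v))
  where
  byCase : Dec (T (isImproperNCT v)) → flip (flip v) ≡ v
  byCase (yes h) = ⇄-functional (flip-⇄ (flip v) (flip-improper v h)) (⇄-sym (flip-⇄ v h))
  byCase (no ¬h) = trans (cong flip (flip-fixed v ¬h)) (flip-fixed v ¬h)

-- Counting even, odd and proper trees

length-filterᵇ-split : ∀ {A : Set} (f g h : A → Bool) →
  (∀ x → (f x ≡ false × g x ≡ false × h x ≡ false) ⊎
         (f x ≡ true × g x ≡ true × h x ≡ false) ⊎
         (f x ≡ true × g x ≡ false × h x ≡ true)) →
  ∀ xs → length (filterᵇ f xs) ≡ length (filterᵇ g xs) + length (filterᵇ h xs)
length-filterᵇ-split f g h split [] = refl
length-filterᵇ-split f g h split (x ∷ xs) with split x | length-filterᵇ-split f g h split xs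
... | inj₁ (fx , gx , hx)        | ih rewrite fx | gx | hx = ih
... | inj₂ (inj₁ (fx , gx , hx)) | ih rewrite fx | gx | hx = cong suc ih
... | inj₂ (inj₂ (fx , gx , hx)) | ih rewrite fx | gx | hx = trans (cong suc ih) (sym (+-suc _ _))

-- The image of one filtered list under `ψ` and the other filtered list are duplicate-free with the
-- same elements, hence permutations of each other.
length-filterᵇ-involution : ∀ {A : Set} (ψ : A → A) (f g : A → Bool) {xs : List A} → Unique xs →
  (∀ x → ψ (ψ x) ≡ x) →
  (∀ x → T (f x) → ψ x ∈ xs × T (g (ψ x))) → (∀ x → T (g x) → ψ x ∈ xs × T (f (ψ x))) →
  length (filterᵇ f xs) ≡ length (filterᵇ g xs)
length-filterᵇ-involution ψ f g {xs} unique involutive f⇒g g⇒f =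
  trans (sym (length-map ψ (filterᵇ f xs)))
    (↭-length (∼bag⇒↭ (unique∧set⇒bag
      (Unique.map⁺ injective (Unique.filter⁺ (T? ∘ f) unique))
      (Unique.filter⁺ (T? ∘ g) unique)
      (mk⇔ forth back))))
  where
  injective : ∀ {x y} → ψ x ≡ ψ y → x ≡ y
  injective {x} {y} eq = trans (sym (involutive x)) (trans (cong ψ eq) (involutive y))
  forth : ∀ {y} → y ∈ map ψ (filterᵇ f xs) → y ∈ filterᵇ g xs
  forth y∈ with x , x∈ , refl ← ∈-map⁻ ψ y∈ =
    let ψx∈ , gψx = f⇒g x (proj₂ (∈-filter⁻ (T? ∘ f) {xs = xs} x∈)) in ∈-filter⁺ (T? ∘ g) ψx∈ gψx
  back : ∀ {y} → y ∈ filterᵇ g xs → y ∈ map ψ (filterᵇ f xs)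
  back {y} y∈ =
    let ψy∈ , fψy = g⇒f y (proj₂ (∈-filter⁻ (T? ∘ g) {xs = xs} y∈))
    in subst (_∈ map ψ (filterᵇ f xs)) (involutive y) (∈-map⁺ ψ (∈-filter⁺ (T? ∘ f) ψy∈ fψy))

module _ (n : ℕ) where

  odd⇒isImproper : (v : Vec ℕ n) → T (isNCT v) → isEvenTree v ≡ false → isProper v ≡ false
  odd⇒isImproper v h odd =
    let t , r = decode v h
    in trans (Represents⇒isProper v r)
         (odd⇒improper v r (trans (sym (Represents⇒isEvenTree v r)) odd))

  private
    evenImproper odd : Vec ℕ n → Bool
    evenImproper v = isImproperNCT v ∧ isEvenTree v
    odd          v = isNCT v ∧ not (isEvenTree v)

    flip-∈ : (v : Vec ℕ n) → T (isImproperNCT v) → flip v ∈ candidates n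
    flip-∈ v h with partners _ r _ ← flip-⇄ v h = ∈-candidates (flip v) r

    flip-not : (v : Vec ℕ n) → T (isImproperNCT v) → isEvenTree (flip v) ≡ not (isEvenTree v)
    flip-not v h = ¬-not (flip-parity v h)

    evenImproper⇒odd : (v : Vec ℕ n) → T (evenImproper v) → flip v ∈ candidates n × T (odd (flip v))
    evenImproper⇒odd v h =
      let improper , even = to T-∧ h
      in flip-∈ v improper , from T-∧ (proj₁ (to T-∧ (flip-improper v improper)) ,
           from T-not-≡ (trans (flip-not v improper) (cong not (to T-≡ even))))

    odd⇒evenImproper : (v : Vec ℕ n) → T (odd v) → flip v ∈ candidates n × T (evenImproper (flip v))
    odd⇒evenImproper v h =
      let tree , ¬even = to T-∧ h
          improper = from T-∧ (tree , from T-not-≡ (odd⇒isImproper v tree (to T-not-≡ ¬even)))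
      in flip-∈ v improper , from T-∧ (flip-improper v improper ,
           from T-≡ (trans (flip-not v improper) (to T-≡ ¬even)))

  -- Even trees are either proper or improper, and `flip` matches the improper ones with the odd
  -- trees, all of which are improper.
  eCount≡tCount+oCount : eCount n ≡ tCount n + oCount n
  eCount≡tCount+oCount = trans
    (length-filterᵇ-split (λ v → isNCT v ∧ isEvenTree v) (λ v → isNCT v ∧ isProper v) evenImproper
      cases (candidates n))
    (cong (λ m → tCount n + m) (length-filterᵇ-involution flip evenImproper odd (candidates-unique n)
      flip-involutive evenImproper⇒odd odd⇒evenImproper))
    where
    cases : (v : Vec ℕ n) →
      (isNCT v ∧ isEvenTree v ≡ false × isNCT v ∧ isProper v ≡ false × evenImproper v ≡ false) ⊎
      (isNCT v ∧ isEvenTree v ≡ true × isNCT v ∧ isProper v ≡ true × evenImproper v ≡ false) ⊎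
      (isNCT v ∧ isEvenTree v ≡ true × isNCT v ∧ isProper v ≡ false × evenImproper v ≡ true)
    cases v with isNCT v | isEvenTree v | isProper v | odd⇒isImproper v
    ... | false | _     | _     | _ = inj₁ (refl , refl , refl)
    ... | true  | true  | true  | _ = inj₂ (inj₁ (refl , refl , refl))
    ... | true  | true  | false | _ = inj₂ (inj₂ (refl , refl , refl))
    ... | true  | false | false | _ = inj₁ (refl , refl , refl)
    ... | true  | false | true  | h = contradiction (h _ refl) λ ()

theorem2p2 : (n : ℕ) → 1 ≤ n →
    Σ (ImproperNCT n → ImproperNCT n) (λ φ →
    ((T : ImproperNCT n) → proj₁ (φ (φ T)) ≡ proj₁ T)
    × ((T : ImproperNCT n) → isEvenTree (proj₁ (φ T)) ≢ isEvenTree (proj₁ T)))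
    × ((+ eCount n) - (+ oCount n) ≡ + tCount n)
theorem2p2 n _ =
  ( (λ (v , h) → flip v , flip-improper v h)
  , (λ (v , _) → flip-involutive v)
  , (λ (v , h) → flip-parity v h) )
  , (begin
      + eCount n - + oCount n              ≡⟨ cong (λ e → + e - + oCount n) (eCount≡tCount+oCount n) ⟩
      + (tCount n + oCount n) - + oCount n ≡⟨ m-n≡m⊖n (tCount n + oCount n) (oCount n) ⟩
      (tCount n + oCount n) ⊖ oCount n     ≡⟨ ⊖-≥ (m≤n+m (oCount n) (tCount n)) ⟩
      + (tCount n + oCount n ∸ oCount n)   ≡⟨ cong +_ (m+n∸n≡m (tCount n) (oCount n)) ⟩
      + tCount n                           ∎)
  where open ≡-Reasoning
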